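{- Let $q=2^r$ with $r\ge 4$ (so $q=4k$ with $k=2^{r-2}$, $r-2\ge 2$). Let $G_1,G_2,G_3\subseteq\mathfrak S_q$ be the groups defined below, and for $s=1,2,3$ let $f_s\in\mathbb F_q[X,Y]$ be a local permutation polynomial whose permutation polynomial tuple consists of the $q$ elements of $G_s$ (in some order). Then, for every $0\le e<r$, none of $f_1,f_2,f_3$ is equivalent to an $e$-Klenian polynomial over $\mathbb F_q$, and $f_1,f_2,f_3$ are pairwise inequivalent.
   Context: The elements of $\mathbb F_q$ are enumerated as $\mathbb F_q=\{c_0,\dots,c_{q-1}\}$; $\mathfrak S_q$ is the symmetric group of permutations of $\mathbb F_q$, composed right to left, $(\sigma\tau)(x)=\sigma(\tau(x))$, written in cycle notation. LPPs and tuples: every function $\mathbb F_q^2\to\mathbb F_q$ is identified with the unique polynomial in $\mathbb F_q[X,Y]$ of degree $<q$ in each variable representing it. $f\in\mathbb F_q[X,Y]$ is a local permutation polynomial (LPP) if $x\mapsto f(x,y_0)$ and $y\mapsto f(x_0,y)$ are permutations of $\mathbb F_q$ for all $x_0,y_0\in\mathbb F_q$. A permutation polynomial tuple is $(\beta_0,\dots,\beta_{q-1})\in\mathfrak S_q^q$ such that $\beta_i^{ -1}\beta_j$ has no fixed point whenever $i\neq j$. LPPs $f$ correspond bijectively to permutation polynomial tuples $\underline\beta_f=(\beta_0,\dots,\beta_{q-1})$ via $f(x,\beta_i(x))=c_i$ for all $x\in\mathbb F_q$ and all $0\le i\le q-1$. Two LPPs $f,g$ with tuples $(\beta_0,\dots,\beta_{q-1})$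 and $(\gamma_0,\dots,\gamma_{q-1})$ are equivalent if there exist $\sigma,\lambda\in\mathfrak S_q$ with $\gamma_i=\sigma\beta_i\lambda$ for all $i$. $e$-Klenian polynomials: for $q=p^r$ ($p$ prime), $0\le e<r$, $\ell=p^e$, $t=q/\ell$, let $\alpha=\prod_{i=0}^{t-1}(c_{i\ell},c_{i\ell+1},\dots,c_{(i+1)\ell-1})$ and $\beta=\prod_{j=0}^{\ell-1}(c_j,c_{j+\ell},\dots,c_{j+(t-1)\ell})$, and $G=\{\alpha^i\beta^j:0\le i\le\ell-1,0\le j\le t-1\}$ (a subgroup of $\mathfrak S_q$ of order $q$ whose non-identity elements have no fixed points). An $e$-Klenian polynomial is an LPP whose permutation polynomial tuple consists of the $q$ elements of $G$ in some order. The groups: with $k=q/4$, let $a=(c_0,c_1)(c_2,c_3)\cdots(c_{q-2},c_{q-1})$ in all three cases. $G_1=\{b_1^ja^i:0\le j\le 2k-1,0\le i\le1\}$ where $b_1=C_1C_2$, $C_1$ the cycle with entries in order: for $m=0,\dots,\frac{k-2}{2}$ the pair $c_{2m},c_{2(2m+k-1)}$; then for $n=0,\dots,\frac{k-4}{2}$ the pair $c_{2n+k},c_{2(2n+k)}$; then $c_{4k-1},c_{4k-4}$; and $C_2$ the cycle with entries in order: for $m=0,\dots,\frac{k-2}{2}$ the pair $c_{2m+1},c_{2(2m+k)+1}$; then for $n=0,\dots,\frac{k-4}{2}$ the pair $c_{2n+k+1},c_{2(2n+k)-1}$; then $c_{4k-2},c_{4k-5}$. $G_2=\{b_2^ja^i:0\le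 j\le \frac q2-1,0\le i\le1\}$ where $b_2=(c_{\frac q2-2},c_{\frac q2-4},\dots,c_2,c_0,c_{\frac q2},c_{\frac q2+2},\dots,c_{q-2})(c_1,c_3,\dots,c_{\frac q2-1},c_{q-1},c_{q-3},\dots,c_{\frac q2+1})$. $G_3=\{b_3^ja^i:0\le j\le 2k-1,0\le i\le1\}$ where $b_3=D_1D_2$, $D_1$ the cycle with entries in order: for $i=0,\dots,\frac{k-2}{2}$ the pair $c_{2i},c_{2i+2k+1}$; then $c_{k+1},c_{3k}$; then for $j=0,\dots,\frac{k-4}{2}$ the pair $c_{k+2j+2},c_{3k+2j+2}$; and $D_2$ the cycle with entries in order: for $j=0,\dots,\frac{k-4}{2}$ the pair $c_{3k-2-2j},c_{2k-1-2j}$; then $c_{2k},c_k$; then for $i=0,\dots,\frac{k-2}{2}$ the pair $c_{4k-1-2i},c_{k-1-2i}$. Each $G_s$ is a subgroup of $\mathfrak S_q$ of order $q$ whose non-identity elements have no fixed points. -}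

module Defs where

open import Algebra.Apartness.Bundles using (HeytingField; HeytingCommutativeRing)
open import Algebra.Bundles using (CommutativeRing)
open import Data.Fin.Base using (Fin; toℕ)
open import Data.Fin.Permutation using (Permutation′; transpose; _∘ₚ_) renaming (id to idₚ)
open import Data.Fin.Properties using (nonZeroIndex)
open import Data.List.Base using (List; []; _∷_; _++_; map; concatMap; foldr; upTo)
open import Data.Nat.Base using (ℕ; zero; suc; _+_; _*_; _∸_; _^_; NonZero)
open import Data.Nat.DivMod using (_/_; _mod_)
open import Data.Nat.Properties using (m^n≢0)
open import Data.Product.Base using (∃₂; _×_; _,_; proj₁; proj₂)
open import Data.Product using (∃!)
open import Function.Bundles using (Inverse)
import Function.Construct.Composition as Composition
import Function.Construct.Identity as Identity
import Function.Construct.Symmetry as Symmetry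
open import Function.Definitions using (Bijective)
open import Level using (Level; _⊔_)
open import Relation.Binary.PropositionalEquality using (_≡_; _≢_)
import Relation.Binary.PropositionalEquality as ≡
open import Relation.Nullary.Negation using (¬_)

-- On a carrier with finitely many elements (up to _≈_) equality is decidable,
-- so the apartness of a Heyting field is just inequality there: a finite
-- Heyting field is a finite field in the usual sense.

fieldRing : ∀ {ℓ₀ ℓ₁ ℓ₂} → HeytingField ℓ₀ ℓ₁ ℓ₂ → CommutativeRing ℓ₀ ℓ₁
fieldRing F = HeytingCommutativeRing.commutativeRing (HeytingField.heytingCommutativeRing F)

Enumeration : ∀ {ℓ₀ ℓ₁ ℓ₂} → HeytingField ℓ₀ ℓ₁ ℓ₂ → ℕ → Set (ℓ₀ ⊔ ℓ₁)
Enumeration F q = Inverse (≡.setoid (Fin q)) (CommutativeRing.setoid (fieldRing F))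

module LocalPermutationPolynomials
  {ℓ₀ ℓ₁ ℓ₂ : Level} (F : HeytingField ℓ₀ ℓ₁ ℓ₂) {q : ℕ} (c : Enumeration F q) where

  private
    module R where
      open CommutativeRing (fieldRing F) public
      open import Algebra.Properties.Semiring.Exp semiring public using (^-congˡ) renaming (_^_ to _^ᴿ_)
      open import Algebra.Properties.Monoid.Sum +-monoid public using (sum; sum-cong-≋)

  open R using (Carrier; _≈_; setoid; 0#)

  𝔖 : Set (ℓ₀ ⊔ ℓ₁)
  𝔖 = Inverse setoid setoid

  _⟨_⟩ : 𝔖 → Carrier → Carrier
  σ ⟨ x ⟩ = Inverse.to σ x

  infix 4 _≋_
  _≋_ : 𝔖 → 𝔖 → Set (ℓ₀ ⊔ ℓ₁)
  σ ≋ τ = ∀ x → σ ⟨ x ⟩ ≈ τ ⟨ x ⟩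

  id𝔖 : 𝔖
  id𝔖 = Identity.inverse setoid

  -- Right-to-left: (σ ∘ τ) ⟨ x ⟩ = σ ⟨ τ ⟨ x ⟩ ⟩.
  infixr 9 _∘_
  _∘_ : 𝔖 → 𝔖 → 𝔖
  σ ∘ τ = Composition.inverse τ σ

  infixr 10 _^𝔖_
  _^𝔖_ : 𝔖 → ℕ → 𝔖
  σ ^𝔖 zero  = id𝔖
  σ ^𝔖 suc n = σ ∘ σ ^𝔖 n

  -- Polynomials in X and Y of degree < q in each variable; f i j is the
  -- coefficient of X^i Y^j.
  Poly : Set ℓ₀
  Poly = Fin q → Fin q → Carrier

  eval : Poly → Carrier → Carrier → Carrier
  eval f x y = R.sum λ i → R.sum λ j → f i j R.* ((x R.^ᴿ toℕ i) R.* (y R.^ᴿ toℕ j))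

  record LPP : Set (ℓ₀ ⊔ ℓ₁) where
    field
      poly        : Poly
      bijective-x : ∀ y₀ → Bijective _≈_ _≈_ (λ x → eval poly x y₀)
      bijective-y : ∀ x₀ → Bijective _≈_ _≈_ (λ y → eval poly x₀ y)

  open LPP using (poly)

  eval-cong : ∀ f {x x′ y y′} → x ≈ x′ → y ≈ y′ → eval f x y ≈ eval f x′ y′
  eval-cong f x≈ y≈ = R.sum-cong-≋ {q} λ i → R.sum-cong-≋ {q} λ j →
    R.*-congˡ {f i j} (R.*-cong (R.^-congˡ (toℕ i) x≈) (R.^-congˡ (toℕ j) y≈))

  -- The permutation polynomial tuple (β₀, …, β_{q-1}) of f; tuple-spec and
  -- tuple-unique say that it is determined by f(x, βᵢ(x)) = cᵢ, and tuple-fixedPointFree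
  -- that βᵢ⁻¹ βⱼ has no fixed point for i ≠ j.
  module _ (f : LPP) where
    private
      injx : ∀ y {x x′} → eval (poly f) x y ≈ eval (poly f) x′ y → x ≈ x′
      injx y = proj₁ (LPP.bijective-x f y)

      injy : ∀ x {y y′} → eval (poly f) x y ≈ eval (poly f) x y′ → y ≈ y′
      injy x = proj₁ (LPP.bijective-y f x)

      solve-x : Carrier → Carrier → Carrier
      solve-x y z = proj₁ (proj₂ (LPP.bijective-x f y) z)

      solve-y : Carrier → Carrier → Carrier
      solve-y x z = proj₁ (proj₂ (LPP.bijective-y f x) z)

      solve-x-spec : ∀ y z → eval (poly f) (solve-x y z) y ≈ z
      solve-x-spec y z = proj₂ (proj₂ (LPP.bijective-x f y) z) R.refl

      solve-y-spec : ∀ x z → eval (poly f) x (solve-y x z) ≈ z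
      solve-y-spec x z = proj₂ (proj₂ (LPP.bijective-y f x) z) R.refl

      unique-x : ∀ {x y z} → eval (poly f) x y ≈ z → x ≈ solve-x y z
      unique-x {x} {y} {z} p = injx y (R.trans p (R.sym (solve-x-spec y z)))

      unique-y : ∀ {x y z} → eval (poly f) x y ≈ z → y ≈ solve-y x z
      unique-y {x} {y} {z} p = injy x (R.trans p (R.sym (solve-y-spec x z)))

    tuple : Fin q → 𝔖
    tuple i = record
      { to        = λ x → solve-y x cᵢ
      ; from      = λ y → solve-x y cᵢ
      ; to-cong   = λ {x} x≈ → unique-y {_} {_} {cᵢ} (R.trans (eval-cong (poly f) (R.sym x≈) R.refl) (solve-y-spec x cᵢ))
      ; from-cong = λ {y} y≈ → unique-x (R.trans (eval-cong (poly f) R.refl (R.sym y≈)) (solve-x-spec y cᵢ))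
      ; inverse   =
          (λ {y} x≈ → R.sym (unique-y (R.trans (eval-cong (poly f) x≈ R.refl) (solve-x-spec y cᵢ))))
        , (λ {x} y≈ → R.sym (unique-x (R.trans (eval-cong (poly f) R.refl y≈) (solve-y-spec x cᵢ))))
      }
      where cᵢ = Inverse.to c i

    tuple-spec : ∀ i x → eval (poly f) x (tuple i ⟨ x ⟩) ≈ Inverse.to c i
    tuple-spec i x = solve-y-spec x (Inverse.to c i)

    tuple-unique : ∀ (β : Fin q → 𝔖) →
                   (∀ i x → eval (poly f) x (β i ⟨ x ⟩) ≈ Inverse.to c i) →
                   ∀ i → β i ≋ tuple i
    tuple-unique β spec i x = unique-y {x} (spec i x)

    tuple-fixedPointFree : ∀ i j → i ≢ j → ∀ x →
                           ¬ ((Symmetry.inverse (tuple i) ∘ tuple j) ⟨ x ⟩ ≈ x)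
    tuple-fixedPointFree i j i≢j x fixed = i≢j (≡.trans (≡.sym (Inverse.strictlyInverseʳ c i))
      (≡.trans (Inverse.from-cong c cᵢ≈cⱼ) (Inverse.strictlyInverseʳ c j)))
      where
        βᵢx≈βⱼx : tuple i ⟨ x ⟩ ≈ tuple j ⟨ x ⟩
        βᵢx≈βⱼx = R.trans (Inverse.to-cong (tuple i) (R.sym fixed))
                          (Inverse.strictlyInverseˡ (tuple i) (tuple j ⟨ x ⟩))

        cᵢ≈cⱼ : Inverse.to c i ≈ Inverse.to c j
        cᵢ≈cⱼ = R.trans (R.sym (tuple-spec i x))
                        (R.trans (eval-cong (poly f) R.refl βᵢx≈βⱼx) (tuple-spec j x))

  Equivalent : LPP → LPP → Set (ℓ₀ ⊔ ℓ₁)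
  Equivalent f g = ∃₂ λ (σ λ′ : 𝔖) → ∀ i → tuple g i ≋ σ ∘ tuple f i ∘ λ′

  -- The tuple lists the elements of G, each exactly once, in some order.
  _ConsistsOf_ : (Fin q → 𝔖) → (𝔖 → Set (ℓ₀ ⊔ ℓ₁)) → Set (ℓ₀ ⊔ ℓ₁)
  β ConsistsOf G = (∀ i → G (β i)) × (∀ σ → G σ → ∃! _≡_ λ i → β i ≋ σ)

  -- Indices of the cₙ are written as natural numbers. Reduction mod q only
  -- makes this total: every index is < q for the q for which the lists are meant.
  index : ℕ → Fin q
  index n = (n mod q) {{nonZeroIndex (Inverse.from c 0#)}}

  -- The cycle (x₁, x₂, …, xₙ), for distinct entries, is the right-to-left
  -- product of transpositions (x₁ x₂)(x₂ x₃)⋯(xₙ₋₁ xₙ). Note that _∘ₚ_ applies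
  -- its left argument first.
  cycleₚ : List (Fin q) → Permutation′ q
  cycleₚ []           = idₚ
  cycleₚ (x ∷ [])     = idₚ
  cycleₚ (x ∷ y ∷ zs) = cycleₚ (y ∷ zs) ∘ₚ transpose x y

  onField : Permutation′ q → 𝔖
  onField π = Composition.inverse (Composition.inverse (Symmetry.inverse c) π) c

  -- Product of the cycles (c_{n₁}, c_{n₂}, …), given by their lists of indices.
  cycles : List (List ℕ) → 𝔖
  cycles = foldr (λ ns σ → onField (cycleₚ (map index ns)) ∘ σ) id𝔖

  Products : (m : ℕ) (σ : 𝔖) (n : ℕ) (τ : 𝔖) → 𝔖 → Set (ℓ₀ ⊔ ℓ₁)
  Products m σ n τ ρ = ∃₂ λ (i : Fin m) (j : Fin n) → ρ ≋ σ ^𝔖 toℕ i ∘ τ ^𝔖 toℕ j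

  -- Here p is the characteristic: q = p ^ r with p prime and e < r.
  module Klenian (p : ℕ) .{{_ : NonZero p}} (e : ℕ) where
    ℓ t : ℕ
    ℓ = p ^ e
    t = (q / ℓ) {{m^n≢0 p e}}

    α β : 𝔖
    α = cycles (map (λ i → map (λ m → i * ℓ + m) (upTo ℓ)) (upTo t))
    β = cycles (map (λ j → map (λ m → j + m * ℓ) (upTo t)) (upTo ℓ))

    G : 𝔖 → Set (ℓ₀ ⊔ ℓ₁)
    G = Products ℓ α t β

  IsKlenian : (p : ℕ) .{{_ : NonZero p}} (e : ℕ) → LPP → Set (ℓ₀ ⊔ ℓ₁)
  IsKlenian p e f = tuple f ConsistsOf Klenian.G p e

  -- The lists below are meant for q = 4k with k even and k ≥ 4; no subtraction
  -- is then truncated and all divisions are exact.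
  k : ℕ
  k = q / 4

  -- The concatenation of the pairs u m, v m for m = 0, …, n (inclusive).
  pairs : (n : ℕ) (u v : ℕ → ℕ) → List ℕ
  pairs n u v = concatMap (λ m → u m ∷ v m ∷ []) (upTo (suc n))

  C₁ C₂ D₁ D₂ E₁ E₂ : List ℕ

  C₁ = pairs ((k ∸ 2) / 2) (λ m → 2 * m) (λ m → 2 * (2 * m + k ∸ 1))
    ++ pairs ((k ∸ 4) / 2) (λ n → 2 * n + k) (λ n → 2 * (2 * n + k))
    ++ 4 * k ∸ 1 ∷ 4 * k ∸ 4 ∷ []

  C₂ = pairs ((k ∸ 2) / 2) (λ m → 2 * m + 1) (λ m → 2 * (2 * m + k) + 1)
    ++ pairs ((k ∸ 4) / 2) (λ n → 2 * n + k + 1) (λ n → 2 * (2 * n + k) ∸ 1)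
    ++ 4 * k ∸ 2 ∷ 4 * k ∸ 5 ∷ []

  D₁ = pairs ((k ∸ 2) / 2) (λ i → 2 * i) (λ i → 2 * i + 2 * k + 1)
    ++ k + 1 ∷ 3 * k ∷ []
    ++ pairs ((k ∸ 4) / 2) (λ j → k + 2 * j + 2) (λ j → 3 * k + 2 * j + 2)

  D₂ = pairs ((k ∸ 4) / 2) (λ j → 3 * k ∸ 2 ∸ 2 * j) (λ j → 2 * k ∸ 1 ∸ 2 * j)
    ++ 2 * k ∷ k ∷ []
    ++ pairs ((k ∸ 2) / 2) (λ i → 4 * k ∸ 1 ∸ 2 * i) (λ i → k ∸ 1 ∸ 2 * i)

  -- E₁ = q/2-2, q/2-4, …, 2, 0, q/2, q/2+2, …, q-2
  E₁ = map (λ m → q / 2 ∸ 2 ∸ 2 * m) (upTo k) ++ map (λ m → q / 2 + 2 * m) (upTo k)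

  -- E₂ = 1, 3, …, q/2-1, q-1, q-3, …, q/2+1
  E₂ = map (λ m → 2 * m + 1) (upTo k) ++ map (λ m → q ∸ 1 ∸ 2 * m) (upTo k)

  a b₁ b₂ b₃ : 𝔖
  a = cycles (map (λ i → 2 * i ∷ 2 * i + 1 ∷ []) (upTo (q / 2)))
  b₁ = cycles (C₁ ∷ C₂ ∷ [])
  b₂ = cycles (E₁ ∷ E₂ ∷ [])
  b₃ = cycles (D₁ ∷ D₂ ∷ [])

  G₁ G₂ G₃ : 𝔖 → Set (ℓ₀ ⊔ ℓ₁)
  G₁ = Products (2 * k) b₁ 2 a
  G₂ = Products (q / 2) b₂ 2 a
  G₃ = Products (2 * k) b₃ 2 a

-- If f ~ g via σ and λ, then σ β σ⁻¹ = (σ β λ)(σ λ)⁻¹ is a quotient of two entries of the tuple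
-- of g for every entry β of the tuple of f, since 1 is also such an entry. So a law that holds in
-- the group generated by the generators for g holds among the entries for f as well. The laws are:
--   Klenian:  x y = y x;
--   G₂, dihedral (b a b = a):  x² = 1 or y² = 1 or x y = y x;
--   G₁, modular (b² and (a b)² are central):  x² y = y x².
-- The first two fail for the entries b and b a of G₁ and G₃, the last one for the entries b and a
-- of G₃, and G₂ is not abelian; each failure is seen at a single point.
module Submission where

open import Algebra.Apartness.Bundles using (HeytingField)
open import Algebra.Bundles using (CommutativeRing)
open import Data.Fin.Base using (Fin; zero; suc; toℕ; fromℕ<)
open import Data.Fin.Permutation using (_⟨$⟩ʳ_)
import Data.Fin.Permutation.Components as PC
open import Data.Fin.Properties
  using ( _≟_; any?; punchOut-injective; injective⇒≤; pigeonhole; toℕ-injective; toℕ<n; toℕ-fromℕ<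
        ; nonZeroIndex; <⇒≢
        )
open import Data.List.Base using (List; []; _∷_; _++_; map; concat; length; lookup; upTo; applyUpTo)
open import Data.List.Properties
  using ( tabulate-lookup; length-++; length-map; length-applyUpTo; map-++; map-upTo; ++-identityʳ
        )
open import Data.List.Membership.Propositional using (_∈_; _∉_)
open import Data.List.Membership.Propositional.Properties
  using ( ∈-++⁺ˡ; ∈-++⁺ʳ; ∈-++⁻; ∈-map⁺; ∈-map⁻; ∈-concat⁺′; ∈-upTo⁺
        )
open import Data.List.Relation.Unary.All as All using ([]; _∷_)
open import Data.List.Relation.Unary.AllPairs using ([]; _∷_)
open import Data.List.Relation.Unary.Any as Any using (here; there)
open import Data.List.Relation.Unary.Any.Properties using (lookup-index)
open import Data.List.Relation.Unary.Unique.Propositional using (Unique)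
open import Data.List.Relation.Unary.Unique.Propositional.Properties using (tabulate⁺)
open import Data.Nat.Base using (ℕ; zero; suc; _+_; _*_; _∸_; _^_; _≤_; _<_; z≤n; s≤s; NonZero)
open import Data.Nat.DivMod
  using ( _/_; _%_; m%n<n; m%n%n≡m%n; m<n⇒m%n≡m; m≡m%n+[m/n]*n; [m+n]%n≡m%n; [m+kn]%n≡m%n; n%n≡0; m*n%n≡0
        ; m%n*o≡m*o%[n*o]; %-congʳ; %-distribˡ-+; +-distrib-/; m/n*n≡m; m*n/n≡m; m<n*o⇒m/o<n
        )
open import Data.Nat.Divisibility using (_∣_; divides)
open import Data.Nat.Properties
  using ( +-assoc; +-cancelˡ-<; +-comm; +-identityʳ; +-monoʳ-<; +-monoˡ-<; +-suc; *-assoc; *-cancelʳ-<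
        ; *-cancelˡ-<; *-comm; *-distribʳ-+; *-distribˡ-+; *-monoʳ-≤; *-monoˡ-<; ^-distribˡ-+-*; 1+n≰n
        ; <-trans; <⇒≤; _<?_; m*n≢0⇒m≢0; m+n∸m≡n; m<m+n; m^n>0; m^n≢0; m∸n+n≡m; m≢1+m+n; m≤m*n; m≤m+n
        ; m≤n⇒m<n∨m≡n; m≤n⇒∃[o]m+o≡n; n<1+n; ≤-pred; ≤-reflexive; ≤-trans; ≮⇒≥
        )
import Data.Nat.Tactic.RingSolver as Ring
open import Data.Product.Base using (∃; _×_; _,_; proj₁; proj₂)
open import Data.Sum.Base using (_⊎_; inj₁; inj₂)
open import Function.Base using (_∘′_)
open import Function.Bundles using (Inverse)
import Function.Construct.Symmetry as Symmetry
open import Function.Definitions using (Injective)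
open import Level using (Level; _⊔_)
open import Relation.Binary.PropositionalEquality
  using ( _≡_; _≢_; refl; sym; trans; cong; cong₂; subst; subst₂
        )
open import Relation.Nullary.Decidable using (yes; no; dec-true; dec-false)
open import Relation.Nullary.Negation using (¬_; contradiction)
open import Defs

-- A product of cycles can be evaluated from its lists only if their entries are distinct, and the
-- index formulas for `b₁`, `b₂`, `b₃` make a direct proof of that laborious. The hypothesis on the
-- tuple supplies it: a generator without fixed points must move every index, so every index is
-- listed, and q listed entries that cover q indices cannot repeat. For `a` and the Klenian
-- generators no such hypothesis is at hand; there covering comes from division with remainder. The
-- other obstacle is that the sets `Products` are not known here to be closed under multiplication.
-- The laws are therefore proved for predicates preserved by right multiplication by the generators
-- and their inverses. Double centralisers take the place of sets of powers in these predicates, so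
-- no arithmetic of exponents or orders is involved.

-- Counting: a covering list of the right length has no repetitions.

-- Were i missed, punching it out would leave an injection into a set with one element fewer than n.
injective⇒surjective : ∀ {m n} (f : Fin m → Fin n) → n ≤ m → Injective _≡_ _≡_ f → ∀ i → ∃ λ x → f x ≡ i
injective⇒surjective {n = suc n} f n≤m inj i with any? (λ x → f x ≟ i)
... | yes hit = hit
... | no miss = contradiction (≤-trans n≤m (injective⇒≤ λ eq → inj (punchOut-injective (avoid _) (avoid _) eq))) 1+n≰n
  where
    avoid : ∀ x → i ≢ f x
    avoid x i≡fx = miss (x , sym i≡fx)

-- Choosing an occurrence of each x gives an injection `pos` into the positions. By counting it is
-- onto, so `lookup` is its two-sided inverse and hence injective.
covering⇒Unique : ∀ {n} (xs : List (Fin n)) → length xs ≡ n → (∀ x → x ∈ xs) → Unique xs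
covering⇒Unique {n} xs len cover = subst Unique (tabulate-lookup xs) (tabulate⁺ lookup-injective)
  where
    pos : Fin n → Fin (length xs)
    pos x = Any.index (cover x)

    lookup-pos : ∀ x → lookup xs (pos x) ≡ x
    lookup-pos x = sym (lookup-index (cover x))

    pos-injective : Injective _≡_ _≡_ pos
    pos-injective {x} {y} eq = trans (sym (lookup-pos x)) (trans (cong (lookup xs) eq) (lookup-pos y))

    pos-lookup : ∀ i → pos (lookup xs i) ≡ i
    pos-lookup i with injective⇒surjective pos (≤-reflexive len) pos-injective i
    ... | x , refl = cong pos (lookup-pos x)

    lookup-injective : ∀ {i j} → lookup xs i ≡ lookup xs j → i ≡ j
    lookup-injective {i} {j} eq = trans (sym (pos-lookup i)) (trans (cong pos eq) (pos-lookup j))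

Unique-++⁻ʳ : ∀ {ℓ} {A : Set ℓ} (xs : List A) {ys} → Unique (xs ++ ys) → Unique ys
Unique-++⁻ʳ []       u       = u
Unique-++⁻ʳ (x ∷ xs) (_ ∷ u) = Unique-++⁻ʳ xs u

Unique-++⁻ˡ : ∀ {ℓ} {A : Set ℓ} (xs : List A) {ys} → Unique (xs ++ ys) → Unique xs
Unique-++⁻ˡ []       _        = []
Unique-++⁻ˡ (x ∷ xs) (x∉ ∷ u) = All.tabulate (λ y∈ → All.lookup x∉ (∈-++⁺ˡ y∈)) ∷ Unique-++⁻ˡ xs u

Unique-++⇒disjoint : ∀ {ℓ} {A : Set ℓ} (xs : List A) {ys} → Unique (xs ++ ys) → ∀ {x} → x ∈ xs → x ∉ ys
Unique-++⇒disjoint (x ∷ xs) (x∉ ∷ u) (here refl) y∈ = All.lookup x∉ (∈-++⁺ʳ xs y∈) refl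
Unique-++⇒disjoint (x ∷ xs) (x∉ ∷ u) (there x∈)  y∈ = Unique-++⇒disjoint xs u x∈ y∈

-- Entries of lists by position.

-- Entry number i, counted from 0, with default value d beyond the end.
at : ∀ {ℓ} {A : Set ℓ} → A → List A → ℕ → A
at d []       _       = d
at d (x ∷ xs) zero    = x
at d (x ∷ xs) (suc i) = at d xs i

module _ {ℓ} {A : Set ℓ} {d : A} where

  at-∈ : ∀ xs {i} → i < length xs → at d xs i ∈ xs
  at-∈ (x ∷ xs) {zero}  _         = here refl
  at-∈ (x ∷ xs) {suc i} (s≤s i<n) = there (at-∈ xs i<n)

  at-index : ∀ {xs} {x : A} → x ∈ xs → ∃ λ i → i < length xs × x ≡ at d xs i
  at-index (here refl) = 0 , s≤s z≤n , refl
  at-index (there x∈) with at-index x∈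
  ... | i , i< , eq = suc i , s≤s i< , eq

  at-++ˡ : ∀ xs {ys i} → i < length xs → at d (xs ++ ys) i ≡ at d xs i
  at-++ˡ (x ∷ xs) {i = zero}  _         = refl
  at-++ˡ (x ∷ xs) {i = suc i} (s≤s i<n) = at-++ˡ xs i<n

  at-++ʳ : ∀ xs {ys i n} → length xs ≡ n → at d (xs ++ ys) (n + i) ≡ at d ys i
  at-++ʳ []       refl = refl
  at-++ʳ (x ∷ xs) refl = at-++ʳ xs refl

  at-applyUpTo : ∀ f {n i} → i < n → at d (applyUpTo f n) i ≡ f i
  at-applyUpTo f {i = zero}  (s≤s _)   = refl
  at-applyUpTo f {i = suc i} (s≤s i<n) = at-applyUpTo (f ∘′ suc) i<n

-- The default is mapped along with the entries, so i needs no bound; this is why `index 0` is the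
-- default in mapped lists below.
at-map : ∀ {ℓ ℓ′} {A : Set ℓ} {B : Set ℓ′} (f : A → B) {d} xs i → at (f d) (map f xs) i ≡ f (at d xs i)
at-map f []       i       = refl
at-map f (x ∷ xs) zero    = refl
at-map f (x ∷ xs) (suc i) = at-map f xs i

at-map-upTo : ∀ {ℓ} {A : Set ℓ} {d : A} f {n i} → i < n → at d (map f (upTo n)) i ≡ f i
at-map-upTo {d = d} f {n} {i} i<n = trans (cong (λ xs → at d xs i) (map-upTo f n)) (at-applyUpTo f i<n)

length-map-upTo : ∀ {ℓ} {A : Set ℓ} (f : ℕ → A) n → length (map f (upTo n)) ≡ n
length-map-upTo f n = trans (cong length (map-upTo f n)) (length-applyUpTo f n)

length-concat-map-upTo : ∀ {ℓ} {A : Set ℓ} (f : ℕ → List A) n {l} → (∀ i → length (f i) ≡ l) →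
                         length (concat (map f (upTo n))) ≡ n * l
length-concat-map-upTo {A = A} f n {l} len = trans (cong (length ∘′ concat) (map-upTo f n)) (go f n len)
  where
    go : ∀ (f : ℕ → List A) n → (∀ i → length (f i) ≡ l) → length (concat (applyUpTo f n)) ≡ n * l
    go f zero    len = refl
    go f (suc n) len = trans (length-++ (f 0)) (cong₂ _+_ (len 0) (go (f ∘′ suc) n (λ i → len (suc i))))

transpose-left : ∀ {n} (i j : Fin n) → PC.transpose i j i ≡ j
transpose-left i j rewrite dec-true (i ≟ i) refl = refl

transpose-right : ∀ {n} (i j : Fin n) → PC.transpose i j j ≡ i
transpose-right i j with j ≟ i
... | yes j≡i = j≡i
... | no _ rewrite dec-true (j ≟ j) refl = refl

transpose-other : ∀ {n} (i j : Fin n) {k} → k ≢ i → k ≢ j → PC.transpose i j k ≡ k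
transpose-other i j {k} k≢i k≢j rewrite dec-false (k ≟ i) k≢i | dec-false (k ≟ j) k≢j = refl

suc-% : ∀ i n .{{_ : NonZero n}} → suc (i % n) < n → suc i % n ≡ suc (i % n)
suc-% i n lt = trans (cong (λ m → suc m % n) (m≡m%n+[m/n]*n i n))
  (trans ([m+kn]%n≡m%n (suc (i % n)) (i / n) n) (m<n⇒m%n≡m lt))

suc-%-wrap : ∀ i n .{{_ : NonZero n}} → suc (i % n) ≡ n → suc i % n ≡ 0
suc-%-wrap i n eq = trans (cong (λ m → suc m % n) (m≡m%n+[m/n]*n i n))
  (trans ([m+kn]%n≡m%n (suc (i % n)) (i / n) n) (trans (cong (_% n) eq) (n%n≡0 n)))

-- Evaluating products of disjoint cycles on the field.

module Enumerated {ℓ₀ ℓ₁ ℓ₂ : Level} (F : HeytingField ℓ₀ ℓ₁ ℓ₂) {q : ℕ} (c : Enumeration F q) where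

  open LocalPermutationPolynomials F c
  open CommutativeRing (fieldRing F) using (Carrier; _≈_; setoid; 0#)
    renaming (refl to ≈-refl; sym to ≈-sym; trans to ≈-trans)
  open import Relation.Binary.Reasoning.Setoid setoid

  to-cong : ∀ (σ : 𝔖) {x y} → x ≈ y → σ ⟨ x ⟩ ≈ σ ⟨ y ⟩
  to-cong σ = Inverse.to-cong σ

  instance
    q≢0 : NonZero q
    q≢0 = nonZeroIndex (Inverse.from c 0#)

  C : ℕ → Carrier
  C n = Inverse.to c (index n)

  toℕ-index : ∀ {n} → n < q → toℕ (index n) ≡ n
  toℕ-index {n} n<q = trans (toℕ-fromℕ< (m%n<n n q)) (m<n⇒m%n≡m n<q)

  index-toℕ : ∀ x → index (toℕ x) ≡ x
  index-toℕ x = toℕ-injective (toℕ-index (toℕ<n x))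

  c-injective : ∀ {x y} → Inverse.to c x ≈ Inverse.to c y → x ≡ y
  c-injective {x} {y} eq = trans (sym (Inverse.strictlyInverseʳ c x))
    (trans (Inverse.from-cong c eq) (Inverse.strictlyInverseʳ c y))

  C-injective : ∀ {m n} → m < q → n < q → C m ≈ C n → m ≡ n
  C-injective m<q n<q eq = trans (sym (toℕ-index m<q)) (trans (cong toℕ (c-injective eq)) (toℕ-index n<q))

  C-reflexive : ∀ {m n} → m ≡ n → C m ≈ C n
  C-reflexive refl = ≈-refl

  C-surjective : ∀ x → ∃ λ n → n < q × x ≈ C n
  C-surjective x = toℕ (Inverse.from c x) , toℕ<n (Inverse.from c x)
    , ≈-sym (≈-trans (Inverse.to-cong c (index-toℕ (Inverse.from c x))) (Inverse.strictlyInverseˡ c x))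

  cycleₚ-fixes : ∀ xs {x} → x ∉ xs → cycleₚ xs ⟨$⟩ʳ x ≡ x
  cycleₚ-fixes []           x∉ = refl
  cycleₚ-fixes (y ∷ [])     x∉ = refl
  cycleₚ-fixes (y ∷ z ∷ zs) x∉ rewrite cycleₚ-fixes (z ∷ zs) (λ x∈ → x∉ (there x∈)) =
    transpose-other y z (λ eq → x∉ (here eq)) (λ eq → x∉ (there (here eq)))

  -- The tail acts before the transposition of x and y. It fixes x, which then goes to y; it moves
  -- any later entry to one beyond y, which the transposition leaves alone.
  cycleₚ-step : ∀ {d} xs → Unique xs → ∀ {i} → suc i < length xs → cycleₚ xs ⟨$⟩ʳ at d xs i ≡ at d xs (suc i)
  cycleₚ-step (x ∷ [])     u            {i}     (s≤s ())
  cycleₚ-step (x ∷ y ∷ zs) (x∉ ∷ u)     {zero}  _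
    rewrite cycleₚ-fixes (y ∷ zs) (λ x∈ → All.lookup x∉ x∈ refl) = transpose-left x y
  cycleₚ-step (x ∷ y ∷ zs) (x∉ ∷ y∉ ∷ u) {suc i} (s≤s (s≤s i<)) =
    trans (cong (PC.transpose x y) (cycleₚ-step (y ∷ zs) (y∉ ∷ u) (s≤s i<)))
          (transpose-other x y (λ eq → All.lookup x∉ (there (at-∈ zs i<)) (sym eq))
                               (λ eq → All.lookup y∉ (at-∈ zs i<) (sym eq)))

  -- The tail sends its last entry back to its head y, and the transposition carries y on to x.
  cycleₚ-last : ∀ {d} x xs → Unique (x ∷ xs) → cycleₚ (x ∷ xs) ⟨$⟩ʳ at d (x ∷ xs) (length xs) ≡ x
  cycleₚ-last x []       _        = refl
  cycleₚ-last x (y ∷ zs) (_ ∷ u) = trans (cong (PC.transpose x y) (cycleₚ-last y zs u)) (transpose-right x y)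

  onField-c : ∀ π x → onField π ⟨ Inverse.to c x ⟩ ≈ Inverse.to c (π ⟨$⟩ʳ x)
  onField-c π x = Inverse.to-cong c (cong (π ⟨$⟩ʳ_) (Inverse.strictlyInverseʳ c x))

  cycles-fixes : ∀ nss {x} → x ∉ map index (concat nss) → cycles nss ⟨ Inverse.to c x ⟩ ≈ Inverse.to c x
  cycles-fixes []         x∉ = ≈-refl
  cycles-fixes (ns ∷ nss) {x} x∉ rewrite map-++ index ns (concat nss) = begin
    onField π ⟨ cycles nss ⟨ Inverse.to c x ⟩ ⟩ ≈⟨ to-cong (onField π) (cycles-fixes nss (λ x∈ → x∉ (∈-++⁺ʳ (map index ns) x∈))) ⟩
    onField π ⟨ Inverse.to c x ⟩                ≈⟨ onField-c π x ⟩
    Inverse.to c (π ⟨$⟩ʳ x)                     ≡⟨ cong (Inverse.to c) (cycleₚ-fixes (map index ns) (λ x∈ → x∉ (∈-++⁺ˡ x∈))) ⟩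
    Inverse.to c x                              ∎
    where π = cycleₚ (map index ns)

  -- By disjointness the factors applied before the cycle of ns fix x, and those applied after it
  -- fix y.
  cycles-restrict : ∀ nss → Unique (map index (concat nss)) → ∀ {ns} → ns ∈ nss →
                    ∀ {x y} → x ∈ map index ns → y ∈ map index ns → cycleₚ (map index ns) ⟨$⟩ʳ x ≡ y →
                    cycles nss ⟨ Inverse.to c x ⟩ ≈ Inverse.to c y
  cycles-restrict (ns ∷ nss) u (here refl) {x} {y} x∈ y∈ eq rewrite map-++ index ns (concat nss) = begin
    onField π ⟨ cycles nss ⟨ Inverse.to c x ⟩ ⟩ ≈⟨ to-cong (onField π) (cycles-fixes nss (Unique-++⇒disjoint _ u x∈)) ⟩
    onField π ⟨ Inverse.to c x ⟩                ≈⟨ onField-c π x ⟩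
    Inverse.to c (π ⟨$⟩ʳ x)                     ≡⟨ cong (Inverse.to c) eq ⟩
    Inverse.to c y                              ∎
    where π = cycleₚ (map index ns)
  cycles-restrict (ms ∷ nss) u (there ns∈) {x} {y} x∈ y∈ eq rewrite map-++ index ms (concat nss) = begin
    onField π ⟨ cycles nss ⟨ Inverse.to c x ⟩ ⟩ ≈⟨ to-cong (onField π) (cycles-restrict nss (Unique-++⁻ʳ (map index ms) u) ns∈ x∈ y∈ eq) ⟩
    onField π ⟨ Inverse.to c y ⟩                ≈⟨ onField-c π y ⟩
    Inverse.to c (π ⟨$⟩ʳ y)                     ≡⟨ cong (Inverse.to c) (cycleₚ-fixes (map index ms) (λ y∈ms → Unique-++⇒disjoint _ u y∈ms y∈concat)) ⟩
    Inverse.to c y                              ∎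
    where
      π = cycleₚ (map index ms)
      y∈concat : y ∈ map index (concat nss)
      y∈concat with ∈-map⁻ index y∈
      ... | n , n∈ , refl = ∈-map⁺ index (∈-concat⁺′ n∈ ns∈)

  Unique-block : ∀ nss → Unique (map index (concat nss)) → ∀ {ns} → ns ∈ nss → Unique (map index ns)
  Unique-block (ns ∷ nss) u (here refl) rewrite map-++ index ns (concat nss) = Unique-++⁻ˡ (map index ns) u
  Unique-block (ms ∷ nss) u (there ns∈) rewrite map-++ index ms (concat nss) = Unique-block nss (Unique-++⁻ʳ (map index ms) u) ns∈

  module Covering (nss : List (List ℕ)) (len : length (concat nss) ≡ q) (cover : ∀ x → x ∈ map index (concat nss)) where

    unique : Unique (map index (concat nss))
    unique = covering⇒Unique _ (trans (length-map index (concat nss)) len) cover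

    private
      restrict : ∀ ns → ns ∈ nss → ∀ i j → i < length ns → j < length ns →
                 cycleₚ (map index ns) ⟨$⟩ʳ at (index 0) (map index ns) i ≡ at (index 0) (map index ns) j →
                 cycles nss ⟨ C (at 0 ns i) ⟩ ≈ C (at 0 ns j)
      restrict ns ns∈ i j i< j< eq = subst₂ (λ x y → cycles nss ⟨ Inverse.to c x ⟩ ≈ Inverse.to c y)
        (at-map index ns i) (at-map index ns j)
        (cycles-restrict nss unique ns∈ (mem i i<) (mem j j<) eq)
        where
          mem : ∀ i → i < length ns → at (index 0) (map index ns) i ∈ map index ns
          mem i i< = at-∈ (map index ns) (subst (i <_) (sym (length-map index ns)) i<)

    step : ∀ {ns} → ns ∈ nss → ∀ {i} → suc i < length ns → cycles nss ⟨ C (at 0 ns i) ⟩ ≈ C (at 0 ns (suc i))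
    step {ns} ns∈ {i} i< = restrict ns ns∈ i (suc i) (<-trans (n<1+n i) i<) i<
      (cycleₚ-step (map index ns) (Unique-block nss unique ns∈) (subst (suc i <_) (sym (length-map index ns)) i<))

    wrap : ∀ {ns} → ns ∈ nss → ∀ {i} → suc i ≡ length ns → cycles nss ⟨ C (at 0 ns i) ⟩ ≈ C (at 0 ns 0)
    wrap {n ∷ ns} ns∈ refl = restrict (n ∷ ns) ns∈ (length ns) 0 (n<1+n _) (s≤s z≤n)
      (trans (cong (λ i → cycleₚ (map index (n ∷ ns)) ⟨$⟩ʳ at (index 0) (map index (n ∷ ns)) i) (sym (length-map index ns)))
             (cycleₚ-last (index n) (map index ns) (Unique-block nss unique ns∈)))

    -- Reducing positions modulo the length merges `step` and `wrap`, so later arguments need no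
    -- case for the end of a cycle.
    rotate : ∀ {ns} → ns ∈ nss → ∀ n .{{_ : NonZero n}} → length ns ≡ n → ∀ i →
             cycles nss ⟨ C (at 0 ns (i % n)) ⟩ ≈ C (at 0 ns (suc i % n))
    rotate {ns} ns∈ n refl i with m≤n⇒m<n∨m≡n (m%n<n i n)
    ... | inj₁ lt = ≈-trans (step ns∈ lt) (C-reflexive (cong (at 0 ns) (sym (suc-% i n lt))))
    ... | inj₂ eq = ≈-trans (wrap ns∈ eq) (C-reflexive (cong (at 0 ns) (sym (suc-%-wrap i n eq))))

-- Permutations, conjugation and equivalence of tuples.

module Conjugation {ℓ₀ ℓ₁ ℓ₂ : Level} (F : HeytingField ℓ₀ ℓ₁ ℓ₂) {q : ℕ} (c : Enumeration F q) where

  open LocalPermutationPolynomials F c hiding (a; k)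
  open CommutativeRing (fieldRing F) using (_≈_; setoid)
    renaming (refl to ≈-refl; sym to ≈-sym; trans to ≈-trans)
  open import Relation.Binary.Reasoning.Setoid setoid
  open Enumerated F c using (to-cong)

  infix 21 _⁻¹
  _⁻¹ : 𝔖 → 𝔖
  σ ⁻¹ = Symmetry.inverse σ

  inverseˡ : ∀ σ x → σ ⁻¹ ⟨ σ ⟨ x ⟩ ⟩ ≈ x
  inverseˡ = Inverse.strictlyInverseʳ

  inverseʳ : ∀ σ x → σ ⟨ σ ⁻¹ ⟨ x ⟩ ⟩ ≈ x
  inverseʳ = Inverse.strictlyInverseˡ

  ≋-sym : ∀ {σ τ} → σ ≋ τ → τ ≋ σ
  ≋-sym eq x = ≈-sym (eq x)

  ≋-trans : ∀ {σ τ υ} → σ ≋ τ → τ ≋ υ → σ ≋ υ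
  ≋-trans p q x = ≈-trans (p x) (q x)

  ⁻¹-cong : ∀ {σ τ} → σ ≋ τ → σ ⁻¹ ≋ τ ⁻¹
  ⁻¹-cong {σ} {τ} eq x = begin
    σ ⁻¹ ⟨ x ⟩                   ≈⟨ to-cong (σ ⁻¹) (inverseʳ τ x) ⟨
    σ ⁻¹ ⟨ τ ⟨ τ ⁻¹ ⟨ x ⟩ ⟩ ⟩    ≈⟨ to-cong (σ ⁻¹) (eq (τ ⁻¹ ⟨ x ⟩)) ⟨
    σ ⁻¹ ⟨ σ ⟨ τ ⁻¹ ⟨ x ⟩ ⟩ ⟩    ≈⟨ inverseˡ σ _ ⟩
    τ ⁻¹ ⟨ x ⟩                   ∎

  ∘-cong : ∀ {σ σ′ τ τ′} → σ ≋ σ′ → τ ≋ τ′ → σ ∘ τ ≋ σ′ ∘ τ′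
  ∘-cong {σ} {τ′ = τ′} p q x = ≈-trans (to-cong σ (q x)) (p (τ′ ⟨ x ⟩))

  involution⇒⁻¹ : ∀ σ → σ ∘ σ ≋ id𝔖 → σ ⁻¹ ≋ σ
  involution⇒⁻¹ σ σσ x = ≈-trans (to-cong (σ ⁻¹) (≈-sym (σσ x))) (inverseˡ σ (σ ⟨ x ⟩))

  conj : 𝔖 → 𝔖 → 𝔖
  conj σ τ = σ ∘ τ ∘ σ ⁻¹

  conj-∘ : ∀ σ τ υ → conj σ τ ∘ conj σ υ ≋ conj σ (τ ∘ υ)
  conj-∘ σ τ υ x = to-cong σ (to-cong τ (inverseˡ σ _))

  conj-injective : ∀ σ {τ υ} → conj σ τ ≋ conj σ υ → τ ≋ υ
  conj-injective σ {τ} {υ} eq x = begin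
    τ ⟨ x ⟩                             ≈⟨ cancel τ ⟨
    σ ⁻¹ ⟨ conj σ τ ⟨ σ ⟨ x ⟩ ⟩ ⟩       ≈⟨ to-cong (σ ⁻¹) (eq (σ ⟨ x ⟩)) ⟩
    σ ⁻¹ ⟨ conj σ υ ⟨ σ ⟨ x ⟩ ⟩ ⟩       ≈⟨ cancel υ ⟩
    υ ⟨ x ⟩                             ∎
    where
      cancel : ∀ τ → σ ⁻¹ ⟨ conj σ τ ⟨ σ ⟨ x ⟩ ⟩ ⟩ ≈ τ ⟨ x ⟩
      cancel τ = ≈-trans (inverseˡ σ _) (to-cong τ (inverseˡ σ x))

  Equivalent-sym : ∀ {f g} → Equivalent f g → Equivalent g f
  Equivalent-sym {f} {g} (σ , λ′ , eq) = σ ⁻¹ , λ′ ⁻¹ , λ i x → begin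
    tuple f i ⟨ x ⟩                                       ≈⟨ to-cong (tuple f i) (inverseʳ λ′ x) ⟨
    tuple f i ⟨ λ′ ⟨ λ′ ⁻¹ ⟨ x ⟩ ⟩ ⟩                      ≈⟨ inverseˡ σ _ ⟨
    σ ⁻¹ ⟨ σ ⟨ tuple f i ⟨ λ′ ⟨ λ′ ⁻¹ ⟨ x ⟩ ⟩ ⟩ ⟩ ⟩       ≈⟨ to-cong (σ ⁻¹) (eq i (λ′ ⁻¹ ⟨ x ⟩)) ⟨
    σ ⁻¹ ⟨ tuple g i ⟨ λ′ ⁻¹ ⟨ x ⟩ ⟩ ⟩                    ∎

  -- Closure under right multiplication by generators and their inverses is just enough for
  -- `quotient`: a quotient of two products is a word in them, built up from the identity.
  record Absorbs {p} (P : 𝔖 → Set p) (α β : 𝔖) : Set (p ⊔ ℓ₀ ⊔ ℓ₁) where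
    field
      resp : ∀ {σ τ} → σ ≋ τ → P σ → P τ
      one  : P id𝔖
      α⁺   : ∀ {σ} → P σ → P (σ ∘ α)
      α⁻   : ∀ {σ} → P σ → P (σ ∘ α ⁻¹)
      β⁺   : ∀ {σ} → P σ → P (σ ∘ β)
      β⁻   : ∀ {σ} → P σ → P (σ ∘ β ⁻¹)

    private
      power⁺ : ∀ γ → (∀ {σ} → P σ → P (σ ∘ γ)) → ∀ n {σ} → P σ → P (σ ∘ γ ^𝔖 n)
      power⁺ γ γ⁺ zero    Pσ = resp (λ _ → ≈-refl) Pσ
      power⁺ γ γ⁺ (suc n) Pσ = resp (λ _ → ≈-refl) (power⁺ γ γ⁺ n (γ⁺ Pσ))

      power⁻ : ∀ γ → (∀ {σ} → P σ → P (σ ∘ γ ⁻¹)) → ∀ n {σ} → P σ → P (σ ∘ (γ ^𝔖 n) ⁻¹)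
      power⁻ γ γ⁻ zero    Pσ = resp (λ _ → ≈-refl) Pσ
      power⁻ γ γ⁻ (suc n) Pσ = resp (λ _ → ≈-refl) (γ⁻ (power⁻ γ γ⁻ n Pσ))

    quotient : ∀ {m n ρ τ} → Products m α n β ρ → Products m α n β τ → P (ρ ∘ τ ⁻¹)
    quotient {ρ = ρ} {τ} (i , j , ρ≋) (i′ , j′ , τ≋) = resp {τ = ρ ∘ τ ⁻¹}
      (λ x → ≈-sym (≈-trans (to-cong ρ (⁻¹-cong {τ} {α ^𝔖 toℕ i′ ∘ β ^𝔖 toℕ j′} τ≋ x)) (ρ≋ _)))
      (power⁻ α α⁻ (toℕ i′) (power⁻ β β⁻ (toℕ j′) (power⁺ β β⁺ (toℕ j) (power⁺ α α⁺ (toℕ i) one))))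

  -- If σ β λ runs through a group H as β runs through G ∋ 1, then σ G σ⁻¹ ⊆ H,
  -- because σ β σ⁻¹ = (σ β λ)(σ 1 λ)⁻¹.
  Equivalent⇒conj : ∀ {p} {P : 𝔖 → Set p} {f g G m α n β} → Equivalent f g → tuple f ConsistsOf G →
                    tuple g ConsistsOf Products m α n β → Absorbs P α β → G id𝔖 →
                    ∃ λ σ → ∀ τ → G τ → P (conj σ τ)
  Equivalent⇒conj {P = P} {f} {g} {G} (σ , λ′ , eq) (_ , onto) (sub , _) absorbs G-id = σ , λ τ Gτ →
    Absorbs.resp absorbs (λ x → begin
      tuple g (i τ Gτ) ⟨ tuple g (i id𝔖 G-id) ⁻¹ ⟨ x ⟩ ⟩        ≈⟨ reaches τ Gτ _ ⟩
      σ ⟨ τ ⟨ λ′ ⟨ tuple g (i id𝔖 G-id) ⁻¹ ⟨ x ⟩ ⟩ ⟩ ⟩          ≈⟨ to-cong σ (to-cong τ (undo x)) ⟩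
      conj σ τ ⟨ x ⟩                                            ∎)
      (Absorbs.quotient absorbs {ρ = tuple g (i τ Gτ)} {tuple g (i id𝔖 G-id)} (sub (i τ Gτ)) (sub (i id𝔖 G-id)))
    where
      i : ∀ τ → G τ → Fin q
      i τ Gτ = proj₁ (onto τ Gτ)

      reaches : ∀ τ (Gτ : G τ) → tuple g (i τ Gτ) ≋ σ ∘ τ ∘ λ′
      reaches τ Gτ x = ≈-trans (eq (i τ Gτ) x) (to-cong σ (proj₁ (proj₂ (onto τ Gτ)) (λ′ ⟨ x ⟩)))

      undo : ∀ x → λ′ ⟨ tuple g (i id𝔖 G-id) ⁻¹ ⟨ x ⟩ ⟩ ≈ σ ⁻¹ ⟨ x ⟩
      undo x = begin
        λ′ ⟨ y ⟩                             ≈⟨ inverseˡ σ _ ⟨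
        σ ⁻¹ ⟨ σ ⟨ λ′ ⟨ y ⟩ ⟩ ⟩              ≈⟨ to-cong (σ ⁻¹) (reaches id𝔖 G-id y) ⟨
        σ ⁻¹ ⟨ tuple g (i id𝔖 G-id) ⟨ y ⟩ ⟩  ≈⟨ to-cong (σ ⁻¹) (inverseʳ (tuple g (i id𝔖 G-id)) x) ⟩
        σ ⁻¹ ⟨ x ⟩                           ∎
        where y = tuple g (i id𝔖 G-id) ⁻¹ ⟨ x ⟩

  -- Commutation and the group laws.

  Commute : 𝔖 → 𝔖 → Set (ℓ₀ ⊔ ℓ₁)
  Commute σ τ = σ ∘ τ ≋ τ ∘ σ

  Commute-sym : ∀ {σ τ} → Commute σ τ → Commute τ σ
  Commute-sym στ x = ≈-sym (στ x)

  Commute-resp : ∀ {σ σ′ τ} → σ ≋ σ′ → Commute σ τ → Commute σ′ τ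
  Commute-resp {τ = τ} eq στ x = ≈-trans (≈-sym (eq _)) (≈-trans (στ x) (to-cong τ (eq x)))

  Commute-∘ : ∀ {σ σ′ τ} → Commute σ τ → Commute σ′ τ → Commute (σ ∘ σ′) τ
  Commute-∘ {σ} {σ′} στ σ′τ x = ≈-trans (to-cong σ (σ′τ x)) (στ (σ′ ⟨ x ⟩))

  Commute-⁻¹ : ∀ {σ τ} → Commute σ τ → Commute (σ ⁻¹) τ
  Commute-⁻¹ {σ} {τ} στ x = begin
    σ ⁻¹ ⟨ τ ⟨ x ⟩ ⟩                       ≈⟨ to-cong (σ ⁻¹) (to-cong τ (inverseʳ σ x)) ⟨
    σ ⁻¹ ⟨ τ ⟨ σ ⟨ σ ⁻¹ ⟨ x ⟩ ⟩ ⟩ ⟩        ≈⟨ to-cong (σ ⁻¹) (στ (σ ⁻¹ ⟨ x ⟩)) ⟨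
    σ ⁻¹ ⟨ σ ⟨ τ ⟨ σ ⁻¹ ⟨ x ⟩ ⟩ ⟩ ⟩        ≈⟨ inverseˡ σ _ ⟩
    τ ⟨ σ ⁻¹ ⟨ x ⟩ ⟩                       ∎

  -- The double centraliser of {α , β}: a group containing α and β whose elements
  -- commute with α and β as soon as these two commute with each other.
  Bicommutant : 𝔖 → 𝔖 → 𝔖 → Set (ℓ₀ ⊔ ℓ₁)
  Bicommutant α β σ = ∀ τ → Commute α τ → Commute β τ → Commute σ τ

  module _ {α β : 𝔖} where

    Bicommutant-resp : ∀ {σ σ′} → σ ≋ σ′ → Bicommutant α β σ → Bicommutant α β σ′
    Bicommutant-resp {σ} {σ′} eq b τ ατ βτ = Commute-resp {σ} {σ′} {τ} eq (b τ ατ βτ)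

    Bicommutant-∘ : ∀ {σ σ′} → Bicommutant α β σ → Bicommutant α β σ′ → Bicommutant α β (σ ∘ σ′)
    Bicommutant-∘ {σ} {σ′} b b′ τ ατ βτ = Commute-∘ {σ} {σ′} {τ} (b τ ατ βτ) (b′ τ ατ βτ)

    Bicommutant-⁻¹ : ∀ {σ} → Bicommutant α β σ → Bicommutant α β (σ ⁻¹)
    Bicommutant-⁻¹ {σ} b τ ατ βτ = Commute-⁻¹ {σ} {τ} (b τ ατ βτ)

    Bicommutant-absorbs : Absorbs (Bicommutant α β) α β
    Bicommutant-absorbs = record
      { resp = λ {σ} {τ} → Bicommutant-resp {σ} {τ}
      ; one  = λ τ _ _ x → ≈-refl
      ; α⁺   = λ {σ} b → Bicommutant-∘ {σ} {α} b (λ τ ατ βτ → ατ)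
      ; α⁻   = λ {σ} b → Bicommutant-∘ {σ} {α ⁻¹} b (λ τ ατ βτ → Commute-⁻¹ {α} {τ} ατ)
      ; β⁺   = λ {σ} b → Bicommutant-∘ {σ} {β} b (λ τ ατ βτ → βτ)
      ; β⁻   = λ {σ} b → Bicommutant-∘ {σ} {β ⁻¹} b (λ τ ατ βτ → Commute-⁻¹ {β} {τ} βτ)
      }

    -- When α and β commute, both lie in the centraliser of the pair, so τ commutes with them. Then
    -- τ itself lies in that centraliser, and σ commutes with τ.
    Bicommutant-commutes : Commute α β → ∀ {σ τ} → Bicommutant α β σ → Bicommutant α β τ → Commute σ τ
    Bicommutant-commutes αβ {σ} {τ} bσ bτ = bσ τ
      (Commute-sym {τ} {α} (bτ α (λ _ → ≈-refl) (Commute-sym {α} {β} αβ)))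
      (Commute-sym {τ} {β} (bτ β αβ (λ _ → ≈-refl)))

  module Dihedral (b a : 𝔖) (aa : a ∘ a ≋ id𝔖) (bab : b ∘ a ∘ b ≋ a) where

    -- The double centraliser of b alone stands in for the powers of b: it is an abelian group
    -- containing b. The first component says that the involution a inverts r.
    Rotation : 𝔖 → Set (ℓ₀ ⊔ ℓ₁)
    Rotation r = (r ∘ a ∘ r ≋ a) × Bicommutant b b r

    Rotation-commutes : ∀ {r s} → Rotation r → Rotation s → Commute r s
    Rotation-commutes {r} {s} (_ , br) (_ , bs) = Bicommutant-commutes {b} {b} (λ _ → ≈-refl) {r} {s} br bs

    Rotation-∘ : ∀ {r s} → Rotation r → Rotation s → Rotation (r ∘ s)
    Rotation-∘ {r} {s} Rr@(rar , br) Rs@(sas , bs) = (λ x → begin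
      r ⟨ s ⟨ a ⟨ r ⟨ s ⟨ x ⟩ ⟩ ⟩ ⟩ ⟩  ≈⟨ to-cong r (to-cong s (to-cong a (Rotation-commutes {r} {s} Rr Rs x))) ⟩
      r ⟨ s ⟨ a ⟨ s ⟨ r ⟨ x ⟩ ⟩ ⟩ ⟩ ⟩  ≈⟨ to-cong r (sas (r ⟨ x ⟩)) ⟩
      r ⟨ a ⟨ r ⟨ x ⟩ ⟩ ⟩              ≈⟨ rar x ⟩
      a ⟨ x ⟩                          ∎) , Bicommutant-∘ {b} {b} {r} {s} br bs

    a∘rotation : ∀ {r} → Rotation r → a ∘ r ≋ r ⁻¹ ∘ a
    a∘rotation {r} (rar , _) x = ≈-trans (≈-sym (inverseˡ r _)) (to-cong (r ⁻¹) (rar x))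

    Rotation-⁻¹ : ∀ {r} → Rotation r → Rotation (r ⁻¹)
    Rotation-⁻¹ {r} Rr@(_ , br) = (λ x → begin
      r ⁻¹ ⟨ a ⟨ r ⁻¹ ⟨ x ⟩ ⟩ ⟩        ≈⟨ a∘rotation {r} Rr (r ⁻¹ ⟨ x ⟩) ⟨
      a ⟨ r ⟨ r ⁻¹ ⟨ x ⟩ ⟩ ⟩           ≈⟨ to-cong a (inverseʳ r x) ⟩
      a ⟨ x ⟩                          ∎) , Bicommutant-⁻¹ {b} {b} {r} br

    Rotation-b : Rotation b
    Rotation-b = bab , λ τ bτ _ → bτ

    Element : 𝔖 → Set (ℓ₀ ⊔ ℓ₁)
    Element σ = ∃ λ r → Rotation r × (σ ≋ r ⊎ σ ≋ r ∘ a)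

    Element-resp : ∀ {σ τ} → σ ≋ τ → Element σ → Element τ
    Element-resp eq (r , Rr , inj₁ p) = r , Rr , inj₁ (λ x → ≈-trans (≈-sym (eq x)) (p x))
    Element-resp eq (r , Rr , inj₂ p) = r , Rr , inj₂ (λ x → ≈-trans (≈-sym (eq x)) (p x))

    Element-∘a : ∀ {σ} → Element σ → Element (σ ∘ a)
    Element-∘a (r , Rr , inj₁ p) = r , Rr , inj₂ (λ x → p (a ⟨ x ⟩))
    Element-∘a (r , Rr , inj₂ p) = r , Rr , inj₁ (λ x → ≈-trans (p (a ⟨ x ⟩)) (to-cong r (aa x)))

    Element-∘rotation : ∀ {σ s} → Rotation s → Element σ → Element (σ ∘ s)
    Element-∘rotation {s = s} Rs (r , Rr , inj₁ p) = r ∘ s , Rotation-∘ {r} {s} Rr Rs , inj₁ (λ x → p (s ⟨ x ⟩))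
    -- Moving s to the left past a inverts it: r a s = r s⁻¹ a.
    Element-∘rotation {s = s} Rs (r , Rr , inj₂ p) = r ∘ s ⁻¹ , Rotation-∘ {r} {s ⁻¹} Rr (Rotation-⁻¹ {s} Rs) ,
      inj₂ (λ x → ≈-trans (p (s ⟨ x ⟩)) (to-cong r (a∘rotation {s} Rs x)))

    absorbs : Absorbs Element b a
    absorbs = record
      { resp = λ {σ} {τ} → Element-resp {σ} {τ}
      ; one  = id𝔖 , ((λ _ → ≈-refl) , λ τ _ _ x → ≈-refl) , inj₁ (λ _ → ≈-refl)
      ; α⁺   = λ {σ} → Element-∘rotation {σ} {b} Rotation-b
      ; α⁻   = λ {σ} → Element-∘rotation {σ} {b ⁻¹} (Rotation-⁻¹ {b} Rotation-b)
      ; β⁺   = λ {σ} → Element-∘a {σ}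
      ; β⁻   = λ {σ} E → Element-resp {σ ∘ a} {σ ∘ a ⁻¹} (λ x → to-cong σ (≈-sym (involution⇒⁻¹ a aa x))) (Element-∘a {σ} E)
      }

    reflection-involutive : ∀ {σ r} → Rotation r → σ ≋ r ∘ a → σ ∘ σ ≋ id𝔖
    reflection-involutive {σ} {r} (rar , _) p x = begin
      σ ⟨ σ ⟨ x ⟩ ⟩             ≈⟨ ∘-cong {σ} {r ∘ a} {σ} {r ∘ a} p p x ⟩
      r ⟨ a ⟨ r ⟨ a ⟨ x ⟩ ⟩ ⟩ ⟩ ≈⟨ rar (a ⟨ x ⟩) ⟩
      a ⟨ a ⟨ x ⟩ ⟩             ≈⟨ aa x ⟩
      x                         ∎

    -- Reflections r a are involutions, and two rotations commute.
    law : ∀ {σ τ} → Element σ → Element τ → σ ∘ σ ≋ id𝔖 ⊎ τ ∘ τ ≋ id𝔖 ⊎ Commute σ τ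
    law {σ} (r , Rr , inj₂ p) _ = inj₁ (reflection-involutive {σ} {r} Rr p)
    law {σ} {τ} (r , Rr , inj₁ p) (s , Rs , inj₂ p′) = inj₂ (inj₁ (reflection-involutive {τ} {s} Rs p′))
    law {σ} {τ} (r , Rr , inj₁ p) (s , Rs , inj₁ p′) = inj₂ (inj₂ (λ x → begin
      σ ⟨ τ ⟨ x ⟩ ⟩  ≈⟨ ∘-cong {σ} {r} {τ} {s} p p′ x ⟩
      r ⟨ s ⟨ x ⟩ ⟩  ≈⟨ Rotation-commutes {r} {s} Rr Rs x ⟩
      s ⟨ r ⟨ x ⟩ ⟩  ≈⟨ ∘-cong {τ} {s} {σ} {r} p′ p x ⟨
      τ ⟨ σ ⟨ x ⟩ ⟩  ∎))

  -- The quotient of ⟨ a , b ⟩ by its centre is the Klein four-group here, so squares are central.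
  module Modular (b a : 𝔖) (aa : a ∘ a ≋ id𝔖) (bba : Commute (b ∘ b) a) (aba-b : Commute (a ∘ b ∘ a) b) where

    -- Commuting with a and b does not by itself make two permutations of the field commute with
    -- each other. The bicommutant component replaces membership in the group generated by a and b
    -- and closes this gap.
    Central : 𝔖 → Set (ℓ₀ ⊔ ℓ₁)
    Central z = Bicommutant a b z × Commute z a × Commute z b

    Central-resp : ∀ {z z′} → z ≋ z′ → Central z → Central z′
    Central-resp {z} {z′} eq (bz , za , zb) = Bicommutant-resp {a} {b} {z} {z′} eq bz
      , Commute-resp {z} {z′} {a} eq za , Commute-resp {z} {z′} {b} eq zb

    Central-∘ : ∀ {z t} → Central z → Central t → Central (z ∘ t)
    Central-∘ {z} {t} (bz , za , zb) (bt , ta , tb) = Bicommutant-∘ {a} {b} {z} {t} bz bt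
      , Commute-∘ {z} {t} {a} za ta , Commute-∘ {z} {t} {b} zb tb

    Central-⁻¹ : ∀ {z} → Central z → Central (z ⁻¹)
    Central-⁻¹ {z} (bz , za , zb) = Bicommutant-⁻¹ {a} {b} {z} bz
      , Commute-⁻¹ {z} {a} za , Commute-⁻¹ {z} {b} zb

    Central-id : Central id𝔖
    Central-id = (λ τ _ _ x → ≈-refl) , (λ _ → ≈-refl) , (λ _ → ≈-refl)

    bicommutant-a : Bicommutant a b a
    bicommutant-a τ aτ bτ = aτ

    bicommutant-b : Bicommutant a b b
    bicommutant-b τ aτ bτ = bτ

    -- κ is the commutator b a b⁻¹ a⁻¹, written as a quotient of two squares so that its centrality
    -- follows from theirs; `ba` is the commutator identity.
    b² [ab]² κ : 𝔖
    b² = b ∘ b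
    [ab]² = a ∘ b ∘ a ∘ b
    κ = [ab]² ∘ b² ⁻¹

    Central-b² : Central b²
    Central-b² = Bicommutant-∘ {a} {b} {b} {b} bicommutant-b bicommutant-b , bba , λ _ → ≈-refl

    Central-[ab]² : Central [ab]²
    Central-[ab]² = Bicommutant-∘ {a} {b} {a} {b ∘ a ∘ b} bicommutant-a
        (Bicommutant-∘ {a} {b} {b} {a ∘ b} bicommutant-b (Bicommutant-∘ {a} {b} {a} {b} bicommutant-a bicommutant-b))
      , (λ x → to-cong a (≈-sym (aba-b x)))
      , (λ x → aba-b (b ⟨ x ⟩))

    Central-κ : Central κ
    Central-κ = Central-∘ {[ab]²} {b² ⁻¹} Central-[ab]² (Central-⁻¹ {b²} Central-b²)

    ba : b ∘ a ≋ κ ∘ a ∘ b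
    ba x = begin
      b ⟨ a ⟨ x ⟩ ⟩                                          ≈⟨ to-cong b (to-cong a (inverseʳ b² x)) ⟨
      b ⟨ a ⟨ b ⟨ b ⟨ s⁻¹ ⟨ x ⟩ ⟩ ⟩ ⟩ ⟩                      ≈⟨ to-cong b (to-cong a (to-cong b (aa _))) ⟨
      b ⟨ a ⟨ b ⟨ a ⟨ a ⟨ b ⟨ s⁻¹ ⟨ x ⟩ ⟩ ⟩ ⟩ ⟩ ⟩ ⟩          ≈⟨ aba-b _ ⟨
      a ⟨ b ⟨ a ⟨ b ⟨ a ⟨ b ⟨ s⁻¹ ⟨ x ⟩ ⟩ ⟩ ⟩ ⟩ ⟩ ⟩          ≈⟨ to-cong [ab]² (to-cong a (proj₂ (proj₂ Cs) x)) ⟨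
      a ⟨ b ⟨ a ⟨ b ⟨ a ⟨ s⁻¹ ⟨ b ⟨ x ⟩ ⟩ ⟩ ⟩ ⟩ ⟩ ⟩          ≈⟨ to-cong [ab]² (proj₁ (proj₂ Cs) (b ⟨ x ⟩)) ⟨
      a ⟨ b ⟨ a ⟨ b ⟨ s⁻¹ ⟨ a ⟨ b ⟨ x ⟩ ⟩ ⟩ ⟩ ⟩ ⟩ ⟩          ∎
      where
        s⁻¹ = b² ⁻¹
        Cs = Central-⁻¹ {b²} Central-b²

    data Representative : 𝔖 → Set (ℓ₀ ⊔ ℓ₁) where
      r-1  : Representative id𝔖
      r-a  : Representative a
      r-b  : Representative b
      r-ab : Representative (a ∘ b)

    Element : 𝔖 → Set (ℓ₀ ⊔ ℓ₁)
    Element σ = ∃ λ z → ∃ λ w → Central z × Representative w × σ ≋ z ∘ w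

    Representative-commutes : ∀ {z w} → Central z → Representative w → Commute z w
    Representative-commutes Cz             r-1  x = ≈-refl
    Representative-commutes (_ , za , zb)  r-a  x = za x
    Representative-commutes (_ , za , zb)  r-b  x = zb x
    Representative-commutes (_ , za , zb)  r-ab x = ≈-trans (za _) (to-cong a (zb x))

    Central-commutes : ∀ {t σ} → Central t → Element σ → Commute t σ
    Central-commutes {t} {σ} Ct@(_ , ta , tb) (z , w , Cz@(bz , _) , Rw , p) x = begin
      t ⟨ σ ⟨ x ⟩ ⟩           ≈⟨ to-cong t (p x) ⟩
      t ⟨ z ⟨ w ⟨ x ⟩ ⟩ ⟩     ≈⟨ bz t (Commute-sym {t} {a} ta) (Commute-sym {t} {b} tb) _ ⟨
      z ⟨ t ⟨ w ⟨ x ⟩ ⟩ ⟩     ≈⟨ to-cong z (Representative-commutes {t} Ct Rw x) ⟩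
      z ⟨ w ⟨ t ⟨ x ⟩ ⟩ ⟩     ≈⟨ p (t ⟨ x ⟩) ⟨
      σ ⟨ t ⟨ x ⟩ ⟩           ∎

    Element-resp : ∀ {σ τ} → σ ≋ τ → Element σ → Element τ
    Element-resp eq (z , w , Cz , Rw , p) = z , w , Cz , Rw , λ x → ≈-trans (≈-sym (eq x)) (p x)

    Element-∘central : ∀ {σ t} → Central t → Element σ → Element (σ ∘ t)
    Element-∘central {t = t} Ct (z , w , Cz , Rw , p) = z ∘ t , w , Central-∘ {z} {t} Cz Ct , Rw ,
      λ x → ≈-trans (p (t ⟨ x ⟩)) (to-cong z (≈-sym (Representative-commutes {t} Ct Rw x)))

    Element-∘a : ∀ {σ} → Element σ → Element (σ ∘ a)
    Element-∘a (z , w , Cz , r-1 , p) = z , a , Cz , r-a , λ x → p (a ⟨ x ⟩)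
    Element-∘a (z , w , Cz , r-a , p) = z , id𝔖 , Cz , r-1 , λ x → ≈-trans (p (a ⟨ x ⟩)) (to-cong z (aa x))
    Element-∘a (z , w , Cz , r-b , p) = z ∘ κ , a ∘ b , Central-∘ {z} {κ} Cz Central-κ , r-ab ,
      λ x → ≈-trans (p (a ⟨ x ⟩)) (to-cong z (ba x))
    Element-∘a {σ} (z , w , Cz , r-ab , p) = z ∘ κ , b , Central-∘ {z} {κ} Cz Central-κ , r-b , λ x → begin
      σ ⟨ a ⟨ x ⟩ ⟩                       ≈⟨ p (a ⟨ x ⟩) ⟩
      z ⟨ a ⟨ b ⟨ a ⟨ x ⟩ ⟩ ⟩ ⟩           ≈⟨ to-cong z (to-cong a (ba x)) ⟩
      z ⟨ a ⟨ κ ⟨ a ⟨ b ⟨ x ⟩ ⟩ ⟩ ⟩ ⟩     ≈⟨ to-cong z (proj₁ (proj₂ Central-κ) _) ⟨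
      z ⟨ κ ⟨ a ⟨ a ⟨ b ⟨ x ⟩ ⟩ ⟩ ⟩ ⟩     ≈⟨ to-cong z (to-cong κ (aa _)) ⟩
      z ⟨ κ ⟨ b ⟨ x ⟩ ⟩ ⟩                 ∎

    Element-∘b : ∀ {σ} → Element σ → Element (σ ∘ b)
    Element-∘b (z , w , Cz , r-1 , p) = z , b , Cz , r-b , λ x → p (b ⟨ x ⟩)
    Element-∘b (z , w , Cz , r-a , p) = z , a ∘ b , Cz , r-ab , λ x → p (b ⟨ x ⟩)
    Element-∘b (z , w , Cz , r-b , p) = z ∘ b² , id𝔖 , Central-∘ {z} {b²} Cz Central-b² , r-1 , λ x → p (b ⟨ x ⟩)
    Element-∘b (z , w , Cz , r-ab , p) = z ∘ b² , a , Central-∘ {z} {b²} Cz Central-b² , r-a ,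
      λ x → ≈-trans (p (b ⟨ x ⟩)) (to-cong z (≈-sym (bba x)))

    absorbs : Absorbs Element b a
    absorbs = record
      { resp = λ {σ} {τ} → Element-resp {σ} {τ}
      ; one  = id𝔖 , id𝔖 , Central-id , r-1 , λ _ → ≈-refl
      ; α⁺   = λ {σ} → Element-∘b {σ}
      -- As b⁻¹ = b⁻² b with b⁻² central, the case analysis for b also serves for its inverse.
      ; α⁻   = λ {σ} E → Element-resp {σ ∘ b² ⁻¹ ∘ b} {σ ∘ b ⁻¹} (λ x → to-cong σ (to-cong (b ⁻¹) (inverseˡ b x)))
                 (Element-∘b {σ ∘ b² ⁻¹} (Element-∘central {σ} {b² ⁻¹} (Central-⁻¹ {b²} Central-b²) E))
      ; β⁺   = λ {σ} → Element-∘a {σ}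
      ; β⁻   = λ {σ} E → Element-resp {σ ∘ a} {σ ∘ a ⁻¹} (λ x → to-cong σ (≈-sym (involution⇒⁻¹ a aa x))) (Element-∘a {σ} E)
      }

    -- (z w)² = z² w², and w² is one of 1, a² = 1, b² and (a b)².
    square-central : ∀ {σ} → Element σ → Central (σ ∘ σ)
    square-central {σ} (z , w , Cz , Rw , p) = Central-resp {(z ∘ z) ∘ (w ∘ w)} {σ ∘ σ} (λ x → begin
      z ⟨ z ⟨ w ⟨ w ⟨ x ⟩ ⟩ ⟩ ⟩    ≈⟨ to-cong z (Representative-commutes {z} Cz Rw _) ⟩
      z ⟨ w ⟨ z ⟨ w ⟨ x ⟩ ⟩ ⟩ ⟩    ≈⟨ ∘-cong {σ} {z ∘ w} {σ} {z ∘ w} p p x ⟨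
      σ ⟨ σ ⟨ x ⟩ ⟩                ∎)
      (Central-∘ {z ∘ z} {w ∘ w} (Central-∘ {z} {z} Cz Cz) (Central-w² Rw))
      where
        Central-w² : ∀ {w} → Representative w → Central (w ∘ w)
        Central-w² r-1  = Central-id
        Central-w² r-a  = Central-resp {id𝔖} {a ∘ a} (λ x → ≈-sym (aa x)) Central-id
        Central-w² r-b  = Central-b²
        Central-w² r-ab = Central-[ab]²

    law : ∀ {σ τ} → Element σ → Element τ → Commute (σ ∘ σ) τ
    law {σ} {τ} Eσ Eτ = Central-commutes {σ ∘ σ} {τ} (square-central {σ} Eσ) Eτ

-- Tuples made of products, and fixed points of their generators.

module Tuples {ℓ₀ ℓ₁ ℓ₂ : Level} (F : HeytingField ℓ₀ ℓ₁ ℓ₂) {q : ℕ} (c : Enumeration F q) where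

  open LocalPermutationPolynomials F c
  open CommutativeRing (fieldRing F) using (_≈_; setoid)
    renaming (refl to ≈-refl; sym to ≈-sym; trans to ≈-trans)
  open import Relation.Binary.Reasoning.Setoid setoid
  open Enumerated F c
  open Conjugation F c
  open import Data.List.Membership.DecPropositional (_≟_ {q}) using (_∈?_)

  Products-∋ : ∀ {m n} σ i τ j → i < m → j < n → Products m σ n τ (σ ^𝔖 i ∘ τ ^𝔖 j)
  Products-∋ σ i τ j i< j< = fromℕ< i< , fromℕ< j< , λ x → begin
      _ ≡⟨ cong₂ (λ i j → (σ ^𝔖 i ∘ τ ^𝔖 j) ⟨ x ⟩) (sym (toℕ-fromℕ< i<)) (sym (toℕ-fromℕ< j<)) ⟩
      _ ∎

  module _ {m : ℕ} {b : 𝔖} {n : ℕ} {a : 𝔖} where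

    ∋-1 : 1 ≤ m → 1 ≤ n → Products m b n a id𝔖
    ∋-1 m≥1 n≥1 = Products-∋ b 0 a 0 m≥1 n≥1

    ∋-b : 2 ≤ m → 1 ≤ n → Products m b n a b
    ∋-b m≥2 n≥1 = Products-∋ b 1 a 0 m≥2 n≥1

    ∋-a : 1 ≤ m → 2 ≤ n → Products m b n a a
    ∋-a m≥1 n≥2 = Products-∋ b 0 a 1 m≥1 n≥2

    ∋-ba : 2 ≤ m → 2 ≤ n → Products m b n a (b ∘ a)
    ∋-ba m≥2 n≥2 = Products-∋ b 1 a 1 m≥2 n≥2

  -- Two entries of a permutation polynomial tuple agreeing at a point coincide; so if b had a
  -- fixed point it would be 1, leaving only the two entries 1 and a.
  generator-fixedPointFree : ∀ {f m b a} → tuple f ConsistsOf Products m b 2 a → 2 ≤ m → 2 < q → ∀ x → ¬ (b ⟨ x ⟩ ≈ x)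
  generator-fixedPointFree {f} {m} {b} {a} (sub , onto) m≥2 q>2 x bx≈x
    with onto id𝔖 (∋-1 (≤-trans (s≤s z≤n) m≥2) (s≤s z≤n)) | onto b (∋-b m≥2 (s≤s z≤n))
  ... | i , i≋ , _ | j , j≋ , _ with i ≟ j
  ...   | no i≢j = tuple-fixedPointFree f i j i≢j x (begin
            tuple f i ⁻¹ ⟨ tuple f j ⟨ x ⟩ ⟩   ≈⟨ to-cong (tuple f i ⁻¹) (≈-trans (j≋ x) bx≈x) ⟩
            tuple f i ⁻¹ ⟨ x ⟩                 ≈⟨ ⁻¹-cong {tuple f i} {id𝔖} i≋ x ⟩
            x                                  ∎)
  ...   | yes refl = contradiction (tuple-injective (≋-trans {tuple f i₁} {a ^𝔖 toℕ e₁} {tuple f i₂} e₁≋ (λ y → begin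
            (a ^𝔖 toℕ e₁) ⟨ y ⟩ ≡⟨ cong (λ e → (a ^𝔖 toℕ e) ⟨ y ⟩) e₁≡e₂ ⟩
            (a ^𝔖 toℕ e₂) ⟨ y ⟩ ≈⟨ e₂≋ y ⟨
            tuple f i₂ ⟨ y ⟩  ∎))) (<⇒≢ i₁<i₂)
    where
      b≋1 : b ≋ id𝔖
      b≋1 y = ≈-trans (≈-sym (j≋ y)) (i≋ y)

      b^n≋1 : ∀ n → b ^𝔖 n ≋ id𝔖
      b^n≋1 zero    y = ≈-refl
      b^n≋1 (suc n) y = ≈-trans (b≋1 _) (b^n≋1 n y)

      exponent : ∀ i → ∃ λ (e : Fin 2) → tuple f i ≋ a ^𝔖 toℕ e
      exponent i with sub i
      ... | d , e , eq = e , λ y → ≈-trans (eq y) (b^n≋1 (toℕ d) _)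

      tuple-injective : ∀ {i j} → tuple f i ≋ tuple f j → i ≡ j
      tuple-injective {i} {j} eq with onto (tuple f j) (sub j)
      ... | k , _ , unique = trans (sym (unique {i} eq)) (unique {j} (λ _ → ≈-refl))

      clash = pigeonhole q>2 (λ i → proj₁ (exponent i))
      i₁ = proj₁ clash
      i₂ = proj₁ (proj₂ clash)
      i₁<i₂ = proj₁ (proj₂ (proj₂ clash))
      e₁≡e₂ = proj₂ (proj₂ (proj₂ clash))
      e₁ = proj₁ (exponent i₁)
      e₂ = proj₁ (exponent i₂)
      e₁≋ = proj₂ (exponent i₁)
      e₂≋ = proj₂ (exponent i₂)

  -- With the lists having q entries in all, this makes the entries distinct without any
  -- inspection of the lists.
  fixedPointFree⇒cover : ∀ nss → (∀ x → ¬ (cycles nss ⟨ x ⟩ ≈ x)) → ∀ x → x ∈ map index (concat nss)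
  fixedPointFree⇒cover nss free x with x ∈? map index (concat nss)
  ... | yes x∈ = x∈
  ... | no  x∉ = contradiction (cycles-fixes nss x∉) (free (Inverse.to c x))

  cover : ∀ {ns} → (∀ n → n < q → n ∈ ns) → ∀ x → x ∈ map index ns
  cover all x = subst (_∈ _) (index-toℕ x) (∈-map⁺ index (all (toℕ x) (toℕ<n x)))

  -- The Klenian generators commute.

  module KlenianGroup (p : ℕ) .{{_ : NonZero p}} (e : ℕ) (p^e∣q : p ^ e ∣ q) where
    open Klenian p e

    private
      instance
        ℓ≢0 : NonZero ℓ
        ℓ≢0 = m^n≢0 p e

      t*ℓ≡q : t * ℓ ≡ q
      t*ℓ≡q = m/n*n≡m p^e∣q

      instance
        t≢0 : NonZero t
        t≢0 = m*n≢0⇒m≢0 t {{subst NonZero (sym t*ℓ≡q) q≢0}}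

      quotient< : ∀ {n} → n < q → n / ℓ < t
      quotient< {n} n<q = m<n*o⇒m/o<n (subst (n <_) (sym t*ℓ≡q) n<q)

      row column : ℕ → List ℕ
      row i    = map (λ m → i * ℓ + m) (upTo ℓ)
      column j = map (λ m → j + m * ℓ) (upTo t)

      row-∋ : ∀ n → n ∈ row (n / ℓ)
      row-∋ n = subst (_∈ row (n / ℓ)) (trans (+-comm _ (n % ℓ)) (sym (m≡m%n+[m/n]*n n ℓ)))
        (∈-map⁺ (λ m → n / ℓ * ℓ + m) (∈-upTo⁺ (m%n<n n ℓ)))

      column-∋ : ∀ n → n < q → n ∈ column (n % ℓ)
      column-∋ n n<q = subst (_∈ column (n % ℓ)) (sym (m≡m%n+[m/n]*n n ℓ))
        (∈-map⁺ (λ m → n % ℓ + m * ℓ) (∈-upTo⁺ (quotient< n<q)))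

      module Rows = Covering (map row (upTo t))
        (trans (length-concat-map-upTo row t (λ i → length-map-upTo _ ℓ)) t*ℓ≡q)
        (cover λ n n<q → ∈-concat⁺′ (row-∋ n) (∈-map⁺ row (∈-upTo⁺ (quotient< n<q))))

      module Columns = Covering (map column (upTo ℓ))
        (trans (length-concat-map-upTo column ℓ (λ i → length-map-upTo _ t)) (trans (*-comm ℓ t) t*ℓ≡q))
        (cover λ n n<q → ∈-concat⁺′ (column-∋ n n<q) (∈-map⁺ column (∈-upTo⁺ (m%n<n n ℓ))))

      α-shift : ∀ {i} → i < t → ∀ m → α ⟨ C (i * ℓ + m % ℓ) ⟩ ≈ C (i * ℓ + suc m % ℓ)
      α-shift {i} i<t m = subst₂ (λ x y → α ⟨ C x ⟩ ≈ C y) (at-map-upTo _ (m%n<n m ℓ)) (at-map-upTo _ (m%n<n (suc m) ℓ))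
        (Rows.rotate (∈-map⁺ row (∈-upTo⁺ i<t)) ℓ (length-map-upTo _ ℓ) m)

      β-shift : ∀ {j} → j < ℓ → ∀ m → β ⟨ C (j + m % t * ℓ) ⟩ ≈ C (j + suc m % t * ℓ)
      β-shift {j} j<ℓ m = subst₂ (λ x y → β ⟨ C x ⟩ ≈ C y) (at-map-upTo _ (m%n<n m t)) (at-map-upTo _ (m%n<n (suc m) t))
        (Columns.rotate (∈-map⁺ column (∈-upTo⁺ j<ℓ)) t (length-map-upTo _ t) m)

    -- Quotient and remainder by ℓ place the indices on a t by ℓ torus; α advances only the
    -- remainder and β only the quotient.
    αβ-commute : Commute α β
    αβ-commute x with C-surjective x
    ... | n , n<q , x≈ = begin
      α ⟨ β ⟨ x ⟩ ⟩                             ≈⟨ to-cong α (to-cong β (≈-trans x≈ (C-reflexive n≡))) ⟩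
      α ⟨ β ⟨ C (j + i % t * ℓ) ⟩ ⟩             ≈⟨ to-cong α (β-shift (m%n<n n ℓ) i) ⟩
      α ⟨ C (j + suc i % t * ℓ) ⟩               ≡⟨ cong (λ m → α ⟨ C m ⟩) (+-comm j _) ⟩
      α ⟨ C (suc i % t * ℓ + n % ℓ) ⟩           ≈⟨ α-shift (m%n<n (suc i) t) n ⟩
      C (suc i % t * ℓ + suc n % ℓ)             ≡⟨ cong C (+-comm (suc i % t * ℓ) _) ⟩
      C (suc n % ℓ + suc i % t * ℓ)             ≈⟨ β-shift (m%n<n (suc n) ℓ) i ⟨
      β ⟨ C (suc n % ℓ + i % t * ℓ) ⟩           ≡⟨ cong (λ m → β ⟨ C m ⟩) (+-comm (suc n % ℓ) _) ⟩
      β ⟨ C (i % t * ℓ + suc n % ℓ) ⟩           ≈⟨ to-cong β (α-shift (m%n<n i t) n) ⟨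
      β ⟨ α ⟨ C (i % t * ℓ + n % ℓ) ⟩ ⟩         ≡⟨ cong (λ m → β ⟨ α ⟨ C m ⟩ ⟩) (+-comm (i % t * ℓ) _) ⟩
      β ⟨ α ⟨ C (j + i % t * ℓ) ⟩ ⟩             ≈⟨ to-cong β (to-cong α (≈-trans x≈ (C-reflexive n≡))) ⟨
      β ⟨ α ⟨ x ⟩ ⟩                             ∎
      where
        i j : ℕ
        i = n / ℓ
        j = n % ℓ
        -- The quotient i is below t already; it is written i % t to match the form of `β-shift`.
        n≡ : n ≡ j + i % t * ℓ
        n≡ = trans (m≡m%n+[m/n]*n n ℓ) (cong (λ m → j + m * ℓ) (sym (m<n⇒m%n≡m (quotient< n<q))))

-- Parity, lists of pairs, and the involution `a`.

m<n⇒1+m*2<n*2 : ∀ {m n} → m < n → suc (m * 2) < n * 2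
m<n⇒1+m*2<n*2 {zero}  (s≤s _)   = s≤s (s≤s z≤n)
m<n⇒1+m*2<n*2 {suc m} (s≤s m<n) = s≤s (s≤s (m<n⇒1+m*2<n*2 m<n))

m<n⇒m*2<n*2 : ∀ {m n} → m < n → m * 2 < n * 2
m<n⇒m*2<n*2 = *-monoˡ-< 2

data Parity : ℕ → Set where
  even : ∀ m → Parity (m * 2)
  odd  : ∀ m → Parity (suc (m * 2))

parity : ∀ n → Parity n
parity zero    = even 0
parity (suc n) with parity n
... | even m = odd m
... | odd  m = even (suc m)

module Lists {ℓ₀ ℓ₁ ℓ₂ : Level} (F : HeytingField ℓ₀ ℓ₁ ℓ₂) {q : ℕ} (c : Enumeration F q) where

  open LocalPermutationPolynomials F c
  open CommutativeRing (fieldRing F) using (_≈_; setoid)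
    renaming (sym to ≈-sym; trans to ≈-trans)
  open import Relation.Binary.Reasoning.Setoid setoid
  open Enumerated F c
  open Tuples F c

  C-% : ∀ n → C (n % q) ≈ C n
  C-% n = Inverse.to-cong c (toℕ-injective (trans (toℕ-index (m%n<n n q)) (sym (toℕ-fromℕ< (m%n<n n q)))))

  pairs-concat : ∀ n u v → pairs n u v ≡ concat (applyUpTo (λ m → u m ∷ v m ∷ []) (suc n))
  pairs-concat n u v = cong concat (map-upTo (λ m → u m ∷ v m ∷ []) (suc n))

  length-pairs : ∀ n u v → length (pairs n u v) ≡ suc n * 2
  length-pairs n u v = length-concat-map-upTo (λ m → u m ∷ v m ∷ []) (suc n) (λ _ → refl)

  at-pairs-even : ∀ n u v {m} → m < suc n → at 0 (pairs n u v) (m * 2) ≡ u m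
  at-pairs-even n u v {m} m<n = trans (cong (λ xs → at 0 xs (m * 2)) (pairs-concat n u v)) (go u v m<n)
    where
      go : ∀ u v {m n} → m < n → at 0 (concat (applyUpTo (λ m → u m ∷ v m ∷ []) n)) (m * 2) ≡ u m
      go u v {zero}  (s≤s _)   = refl
      go u v {suc m} (s≤s m<n) = go (u ∘′ suc) (v ∘′ suc) m<n

  at-pairs-odd : ∀ n u v {m} → m < suc n → at 0 (pairs n u v) (suc (m * 2)) ≡ v m
  at-pairs-odd n u v {m} m<n = trans (cong (λ xs → at 0 xs (suc (m * 2))) (pairs-concat n u v)) (go u v m<n)
    where
      go : ∀ u v {m n} → m < n → at 0 (concat (applyUpTo (λ m → u m ∷ v m ∷ []) n)) (suc (m * 2)) ≡ v m
      go u v {zero}  (s≤s _)   = refl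
      go u v {suc m} (s≤s m<n) = go (u ∘′ suc) (v ∘′ suc) m<n

  module Swap (N : ℕ) (q≡ : q ≡ N * 2) where

    private
      q/2≡N : q / 2 ≡ N
      q/2≡N = trans (cong (_/ 2) q≡) (m*n/n≡m N 2)

      instance
        N≢0 : NonZero N
        N≢0 = m*n≢0⇒m≢0 N {{subst NonZero q≡ q≢0}}
        N*2≢0 : NonZero (N * 2)
        N*2≢0 = subst NonZero q≡ q≢0

      pair : ℕ → List ℕ
      pair i = 2 * i ∷ 2 * i + 1 ∷ []

      pair-∋ : ∀ n → n ∈ pair (n / 2)
      pair-∋ n with parity n
      ... | even m = here (trans (*-comm m 2) (cong (2 *_) (sym (m*n/n≡m m 2))))
      ... | odd  m = there (here (trans (trans (cong suc (*-comm m 2)) (sym (+-comm (2 * m) 1))) (cong (λ m → 2 * m + 1) (sym ([1+m*2]/2 m)))))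
        where
          [1+m*2]/2 : ∀ m → suc (m * 2) / 2 ≡ m
          [1+m*2]/2 m = trans (+-distrib-/ 1 (m * 2) (subst (λ x → 1 + x < 2) (sym (m*n%n≡0 m 2)) (s≤s (s≤s z≤n)))) (m*n/n≡m m 2)

      module Pairs = Covering (map pair (upTo (q / 2)))
        (trans (length-concat-map-upTo pair (q / 2) (λ i → refl)) (trans (cong (_* 2) q/2≡N) (sym q≡)))
        (cover λ n n<q → ∈-concat⁺′ (pair-∋ n) (∈-map⁺ pair (∈-upTo⁺
          (subst (n / 2 <_) (sym q/2≡N) (m<n*o⇒m/o<n (subst (n <_) q≡ n<q))))))

      pair-∈ : ∀ m → pair (m % N) ∈ map pair (upTo (q / 2))
      pair-∈ m = ∈-map⁺ pair (∈-upTo⁺ (subst (m % N <_) (sym q/2≡N) (m%n<n m N)))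

      [2*m]%q : ∀ m → 2 * (m % N) ≡ (2 * m) % q
      [2*m]%q m = trans (*-comm 2 (m % N)) (trans (m%n*o≡m*o%[n*o] m N 2)
        (trans (cong (_% (N * 2)) (*-comm m 2)) (%-congʳ (sym q≡))))

      C-even : ∀ m → C (2 * (m % N)) ≈ C (2 * m)
      C-even m = ≈-trans (C-reflexive ([2*m]%q m)) (C-% (2 * m))

      C-odd : ∀ m → C (2 * (m % N) + 1) ≈ C (2 * m + 1)
      C-odd m = begin
        C (2 * (m % N) + 1)               ≡⟨ cong C (+-comm _ 1) ⟩
        C (suc (2 * (m % N)))             ≡⟨ cong (λ x → C (suc x)) ([2*m]%q m) ⟩
        C (suc ((2 * m) % q))             ≈⟨ C-% _ ⟨
        C (suc ((2 * m) % q) % q)         ≡⟨ cong C (suc%% (2 * m)) ⟩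
        C (suc (2 * m) % q)               ≈⟨ C-% _ ⟩
        C (suc (2 * m))                   ≡⟨ cong C (+-comm _ 1) ⟨
        C (2 * m + 1)                     ∎
        where
          suc%% : ∀ n → suc (n % q) % q ≡ suc n % q
          suc%% n = trans (%-distribˡ-+ 1 (n % q) q) (trans (cong (λ x → (1 % q + x) % q) (m%n%n≡m%n n q)) (sym (%-distribˡ-+ 1 n q)))

    -- No bound on m is required: `C` has period q = 2 N, so m can first be reduced modulo N.
    a-even : ∀ m → a ⟨ C (2 * m) ⟩ ≈ C (2 * m + 1)
    a-even m = begin
      a ⟨ C (2 * m) ⟩                     ≈⟨ to-cong a (C-even m) ⟨
      a ⟨ C (2 * (m % N)) ⟩               ≈⟨ Pairs.step (pair-∈ m) (s≤s (s≤s z≤n)) ⟩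
      C (2 * (m % N) + 1)                 ≈⟨ C-odd m ⟩
      C (2 * m + 1)                       ∎

    a-odd : ∀ m → a ⟨ C (2 * m + 1) ⟩ ≈ C (2 * m)
    a-odd m = begin
      a ⟨ C (2 * m + 1) ⟩                 ≈⟨ to-cong a (C-odd m) ⟨
      a ⟨ C (2 * (m % N) + 1) ⟩           ≈⟨ Pairs.wrap (pair-∈ m) {1} refl ⟩
      C (2 * (m % N))                     ≈⟨ C-even m ⟩
      C (2 * m)                           ∎

    a∘a : a ∘ a ≋ id𝔖
    a∘a x with C-surjective x
    ... | n , _ , x≈ with parity n
    ...   | even m = begin
      a ⟨ a ⟨ x ⟩ ⟩            ≈⟨ to-cong a (to-cong a (≈-trans x≈ (C-reflexive (*-comm m 2)))) ⟩
      a ⟨ a ⟨ C (2 * m) ⟩ ⟩    ≈⟨ to-cong a (a-even m) ⟩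
      a ⟨ C (2 * m + 1) ⟩      ≈⟨ a-odd m ⟩
      C (2 * m)                ≈⟨ ≈-trans x≈ (C-reflexive (*-comm m 2)) ⟨
      x                        ∎
    ...   | odd m = begin
      a ⟨ a ⟨ x ⟩ ⟩            ≈⟨ to-cong a (to-cong a x≈′) ⟩
      a ⟨ a ⟨ C (2 * m + 1) ⟩ ⟩ ≈⟨ to-cong a (a-odd m) ⟩
      a ⟨ C (2 * m) ⟩          ≈⟨ a-even m ⟩
      C (2 * m + 1)            ≈⟨ x≈′ ⟨
      x                        ∎
      where
        x≈′ : x ≈ C (2 * m + 1)
        x≈′ = ≈-trans x≈ (C-reflexive (trans (cong suc (*-comm m 2)) (sym (+-comm (2 * m) 1))))

-- Truncated subtraction is evaluated by exhibiting the minuend as a sum, which leaves a polynomial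
-- identity to the ring solver.
∸-∸-≡ : ∀ {x} y z {w} → x ≡ y + (z + w) → x ∸ y ∸ z ≡ w
∸-∸-≡ y z {w} refl = trans (cong (_∸ z) (m+n∸m≡n y (z + w))) (m+n∸m≡n z w)

complement : ∀ {m n} → m < n → ∃ λ i → suc (i + m) ≡ n
complement {m} {suc n} (s≤s m≤n) = n ∸ m , cong suc (m∸n+n≡m m≤n)

quadruple : ∀ k → (k + k) + (k + k) ≡ k * 4
quadruple = Ring.solve-∀

double-suc : ∀ i m → suc (i + m) * 2 ≡ 2 + (2 * i + 2 * m)
double-suc = Ring.solve-∀

quadruple-suc : ∀ i m → suc (i + m) * 4 ≡ 1 + (2 * i + (2 * (suc (i + m) + m) + 1))
quadruple-suc = Ring.solve-∀

-- The dihedral relation for `b₂`.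

module Dihedral₂ {ℓ₀ ℓ₁ ℓ₂ : Level} (F : HeytingField ℓ₀ ℓ₁ ℓ₂) {q : ℕ} (c : Enumeration F q) where

  open LocalPermutationPolynomials F c
  open CommutativeRing (fieldRing F) using (_≈_; setoid)
    renaming (sym to ≈-sym; trans to ≈-trans)
  open import Relation.Binary.Reasoning.Setoid setoid
  open Enumerated F c
  open Tuples F c
  open Lists F c

  module Relation₂ (q≡ : q ≡ k * 4) (free : ∀ x → ¬ (b₂ ⟨ x ⟩ ≈ x)) where

    private
      [k*2]*2 : k * 4 ≡ k * 2 * 2
      [k*2]*2 = sym (*-assoc k 2 2)

      q/2≡ : q / 2 ≡ k * 2
      q/2≡ = trans (cong (_/ 2) (trans q≡ [k*2]*2)) (m*n/n≡m (k * 2) 2)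

      length-E₁ : length E₁ ≡ k + k
      length-E₁ = trans (length-++ (map (λ m → q / 2 ∸ 2 ∸ 2 * m) (upTo k))) (cong₂ _+_ (length-map-upTo _ k) (length-map-upTo _ k))

      length-E₂ : length E₂ ≡ k + k
      length-E₂ = trans (length-++ (map (λ m → 2 * m + 1) (upTo k))) (cong₂ _+_ (length-map-upTo _ k) (length-map-upTo _ k))

      module B = Covering (E₁ ∷ E₂ ∷ [])
        (trans (length-++ E₁) (trans (cong₂ _+_ length-E₁ (trans (cong length (++-identityʳ E₂)) length-E₂))
          (trans (quadruple k) (sym q≡))))
        (fixedPointFree⇒cover (E₁ ∷ E₂ ∷ []) free)

      -- The position i of the entry 2 m is given by i + m + 1 = k, to avoid subtraction.
      E₁-low : ∀ {i m} → suc (i + m) ≡ k → at 0 E₁ i ≡ 2 * m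
      E₁-low {i} {m} eq = trans (at-++ˡ (map (λ m → q / 2 ∸ 2 ∸ 2 * m) (upTo k)) (subst (i <_) (sym (length-map-upTo _ k)) i<k))
        (trans (at-map-upTo _ i<k) (∸-∸-≡ 2 (2 * i) (trans q/2≡ (trans (cong (_* 2) (sym eq)) (double-suc i m)))))
        where
          i<k : i < k
          i<k = subst (i <_) eq (s≤s (m≤m+n i m))

      E₁-high : ∀ {m} → m < k → at 0 E₁ (k + m) ≡ 2 * (k + m)
      E₁-high {m} m<k = trans (at-++ʳ (map (λ m → q / 2 ∸ 2 ∸ 2 * m) (upTo k)) (length-map-upTo _ k))
        (trans (at-map-upTo _ m<k) (trans (cong (_+ 2 * m) (trans q/2≡ (*-comm k 2))) (sym (*-distribˡ-+ 2 k m))))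

      E₂-low : ∀ {m} → m < k → at 0 E₂ m ≡ 2 * m + 1
      E₂-low {m} m<k = trans (at-++ˡ (map (λ m → 2 * m + 1) (upTo k)) (subst (m <_) (sym (length-map-upTo _ k)) m<k)) (at-map-upTo _ m<k)

      E₂-high : ∀ {i m} → suc (i + m) ≡ k → at 0 E₂ (k + i) ≡ 2 * (k + m) + 1
      E₂-high {i} {m} eq = trans (at-++ʳ (map (λ m → 2 * m + 1) (upTo k)) (length-map-upTo _ k))
        (trans (at-map-upTo _ i<k) (∸-∸-≡ 1 (2 * i) (trans q≡ (split k eq))))
        where
          i<k : i < k
          i<k = subst (i <_) eq (s≤s (m≤m+n i m))
          split : ∀ k → suc (i + m) ≡ k → k * 4 ≡ 1 + (2 * i + (2 * (k + m) + 1))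
          split _ refl = quadruple-suc i m

      b-step₁ : ∀ {i x y} → suc i < k + k → at 0 E₁ i ≡ x → at 0 E₁ (suc i) ≡ y → b₂ ⟨ C x ⟩ ≈ C y
      b-step₁ i< refl refl = B.step (here refl) (subst (_ <_) (sym length-E₁) i<)

      b-wrap₁ : ∀ {i x y} → suc i ≡ k + k → at 0 E₁ i ≡ x → at 0 E₁ 0 ≡ y → b₂ ⟨ C x ⟩ ≈ C y
      b-wrap₁ i≡ refl refl = B.wrap (here refl) (trans i≡ (sym length-E₁))

      b-step₂ : ∀ {i x y} → suc i < k + k → at 0 E₂ i ≡ x → at 0 E₂ (suc i) ≡ y → b₂ ⟨ C x ⟩ ≈ C y
      b-step₂ i< refl refl = B.step (there (here refl)) (subst (_ <_) (sym length-E₂) i<)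

      b-wrap₂ : ∀ {i x y} → suc i ≡ k + k → at 0 E₂ i ≡ x → at 0 E₂ 0 ≡ y → b₂ ⟨ C x ⟩ ≈ C y
      b-wrap₂ i≡ refl refl = B.wrap (there (here refl)) (trans i≡ (sym length-E₂))

      k>0 : ∀ {i m} → suc (i + m) ≡ k → 0 < k
      k>0 eq = subst (0 <_) eq (s≤s z≤n)

      even-down : ∀ {m} → suc m < k → b₂ ⟨ C (2 * suc m) ⟩ ≈ C (2 * m)
      even-down {m} m< with complement m<
      ... | i , eq = b-step₁ (≤-trans (subst (suc (suc i) ≤_) eq (s≤s (subst (suc i ≤_) (sym (+-suc i m)) (s≤s (m≤m+n i m))))) (m≤m+n k k))
        (E₁-low eq) (E₁-low (trans (cong suc (sym (+-suc i m))) eq))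

      even-turn : 0 < k → b₂ ⟨ C (2 * 0) ⟩ ≈ C (2 * (k + 0))
      even-turn 0<k with complement 0<k
      ... | i , eq = b-step₁ {i} (subst (_< k + k) (sym 1+i≡k) (m<m+n k 0<k))
          (E₁-low eq) (trans (cong (at 0 E₁) (trans 1+i≡k (sym (+-identityʳ k)))) (E₁-high 0<k))
        where
          1+i≡k : suc i ≡ k
          1+i≡k = trans (cong suc (sym (+-identityʳ i))) eq

      even-up : ∀ {m} → suc m < k → b₂ ⟨ C (2 * (k + m)) ⟩ ≈ C (2 * (k + suc m))
      even-up {m} m< = b-step₁ (subst (_< k + k) (+-suc k m) (+-monoʳ-< k m<))
        (E₁-high (<-trans (n<1+n m) m<)) (trans (cong (at 0 E₁) (sym (+-suc k m))) (E₁-high m<))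

      even-return : ∀ {m} → suc m ≡ k → b₂ ⟨ C (2 * (k + m)) ⟩ ≈ C (2 * m)
      even-return {m} eq = b-wrap₁ (trans (sym (+-suc k m)) (cong (k +_) eq)) (E₁-high (subst (m <_) eq (n<1+n m))) (E₁-low eq)

      odd-up : ∀ {m} → suc m < k → b₂ ⟨ C (2 * m + 1) ⟩ ≈ C (2 * suc m + 1)
      odd-up {m} m< = b-step₂ (≤-trans m< (m≤m+n k k)) (E₂-low (<-trans (n<1+n m) m<)) (E₂-low m<)

      odd-turn : ∀ {m} → suc m ≡ k → b₂ ⟨ C (2 * m + 1) ⟩ ≈ C (2 * (k + m) + 1)
      odd-turn {m} eq = b-step₂ {m} (subst (_< k + k) (sym eq) (m<m+n k (k>0 {0} eq)))
        (E₂-low (subst (m <_) eq (n<1+n m))) (trans (cong (at 0 E₂) (trans eq (sym (+-identityʳ k)))) (E₂-high {0} eq))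

      odd-down : ∀ {m} → suc m < k → b₂ ⟨ C (2 * (k + suc m) + 1) ⟩ ≈ C (2 * (k + m) + 1)
      odd-down {m} m< with complement m<
      ... | i , eq = b-step₂ {k + i} (subst (_< k + k) (+-suc k i) (+-monoʳ-< k (subst (suc i <_) eq (s≤s (subst (suc i ≤_) (sym (+-suc i m)) (s≤s (m≤m+n i m)))))))
        (E₂-high eq) (trans (cong (at 0 E₂) (sym (+-suc k i))) (E₂-high (trans (cong suc (sym (+-suc i m))) eq)))

      odd-return : 0 < k → b₂ ⟨ C (2 * (k + 0) + 1) ⟩ ≈ C (2 * 0 + 1)
      odd-return 0<k with complement 0<k
      ... | i , eq = b-wrap₂ {k + i} (trans (sym (+-suc k i)) (cong (k +_) (trans (cong suc (sym (+-identityʳ i))) eq)))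
        (E₂-high eq) (E₂-low 0<k)

    open Swap (k * 2) (trans q≡ [k*2]*2) public

    private
      via : ∀ {x y z w} → b₂ ⟨ C x ⟩ ≈ C y → a ⟨ C y ⟩ ≈ C z → b₂ ⟨ C z ⟩ ≈ C w → a ⟨ C x ⟩ ≈ C w →
            b₂ ⟨ a ⟨ b₂ ⟨ C x ⟩ ⟩ ⟩ ≈ a ⟨ C x ⟩
      via p p′ p″ p‴ = ≈-trans (to-cong b₂ (≈-trans (to-cong a p) p′)) (≈-trans p″ (≈-sym p‴))

      -- If `b₂` sends index 2 m to 2 π(m), then it sends 2 π(m) + 1 to 2 m + 1: on odd indices it
      -- runs π backwards. Thus down pairs with up, and turn with return, while `a` passes between
      -- the two cycles.
      bab-even : ∀ m → m < k * 2 → b₂ ⟨ a ⟨ b₂ ⟨ C (2 * m) ⟩ ⟩ ⟩ ≈ a ⟨ C (2 * m) ⟩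
      bab-even m m<2k with m <? k
      bab-even zero    m<2k | yes 0<k = via (even-turn 0<k) (a-even (k + 0)) (odd-return 0<k) (a-even 0)
      bab-even (suc m) m<2k | yes m<k = via (even-down m<k) (a-even m) (odd-up m<k) (a-even (suc m))
      bab-even m m<2k | no m≮k with m≤n⇒∃[o]m+o≡n (≮⇒≥ m≮k)
      ... | n , refl with m≤n⇒m<n∨m≡n (+-cancelˡ-< k n k (subst (k + n <_) (trans (*-comm k 2) (cong (k +_) (+-identityʳ k))) m<2k))
      ...   | inj₁ n<k = via (even-up n<k) (a-even (k + suc n)) (odd-down n<k) (a-even (k + n))
      ...   | inj₂ n≡k = via (even-return n≡k) (a-even n) (odd-turn n≡k) (a-even (k + n))

      bab-odd : ∀ m → m < k * 2 → b₂ ⟨ a ⟨ b₂ ⟨ C (2 * m + 1) ⟩ ⟩ ⟩ ≈ a ⟨ C (2 * m + 1) ⟩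
      bab-odd m m<2k with m <? k
      ... | yes m<k with m≤n⇒m<n∨m≡n m<k
      ...   | inj₁ m<k′ = via (odd-up m<k′) (a-odd (suc m)) (even-down m<k′) (a-odd m)
      ...   | inj₂ m≡k  = via (odd-turn m≡k) (a-odd (k + m)) (even-return m≡k) (a-odd m)
      bab-odd m m<2k | no m≮k with m≤n⇒∃[o]m+o≡n (≮⇒≥ m≮k) | +-cancelˡ-< k
      ... | zero  , refl | cancel = via (odd-return 0<k) (a-odd 0) (even-turn 0<k) (a-odd (k + 0))
        where 0<k = cancel 0 k (subst (k + 0 <_) (trans (*-comm k 2) (cong (k +_) (+-identityʳ k))) m<2k)
      ... | suc n , refl | cancel = via (odd-down n<k) (a-odd (k + n)) (even-up n<k) (a-odd (k + suc n))
        where n<k = cancel (suc n) k (subst (k + suc n <_) (trans (*-comm k 2) (cong (k +_) (+-identityʳ k))) m<2k)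

    b₂ab₂ : b₂ ∘ a ∘ b₂ ≋ a
    b₂ab₂ x with C-surjective x
    ... | n , n<q , x≈ = ≈-trans (to-cong (b₂ ∘ a ∘ b₂) x≈) (≈-trans (on-C n n<q) (to-cong a (≈-sym x≈)))
      where
        on-C : ∀ n → n < q → b₂ ⟨ a ⟨ b₂ ⟨ C n ⟩ ⟩ ⟩ ≈ a ⟨ C n ⟩
        on-C n n<q with parity n
        ... | even m rewrite *-comm m 2 = bab-even m (*-cancelˡ-< 2 m (k * 2) (subst (2 * m <_) (trans q≡ (trans [k*2]*2 (*-comm (k * 2) 2))) n<q))
        ... | odd m rewrite *-comm m 2 | sym (+-comm (2 * m) 1) = bab-odd m (*-cancelˡ-< 2 m (k * 2)
                (<-trans (n<1+n (2 * m)) (subst₂ _<_ (+-comm (2 * m) 1) (trans q≡ (trans [k*2]*2 (*-comm (k * 2) 2))) n<q)))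

    -- At `C 0` the two sides are `C 3` and C (2 k + 1); k ≥ 2 separates them.
    b₂a≉ab₂ : 2 ≤ k → ¬ (b₂ ∘ a ≋ a ∘ b₂)
    b₂a≉ab₂ k≥2 eq = absurd k k≥2 q≡ (C-injective (3<q k k≥2 q≡) (2k+1<q k k≥2 q≡) (begin
      C 3                    ≈⟨ odd-up k≥2 ⟨
      b₂ ⟨ C 1 ⟩             ≈⟨ to-cong b₂ (a-even 0) ⟨
      b₂ ⟨ a ⟨ C 0 ⟩ ⟩       ≈⟨ eq (C 0) ⟩
      a ⟨ b₂ ⟨ C 0 ⟩ ⟩       ≈⟨ to-cong a (even-turn (<-trans (s≤s z≤n) k≥2)) ⟩
      a ⟨ C (2 * (k + 0)) ⟩  ≈⟨ a-even (k + 0) ⟩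
      C (2 * (k + 0) + 1)    ∎))
      where
        3<q : ∀ k → 2 ≤ k → q ≡ k * 4 → 3 < q
        3<q (suc k) _ refl = s≤s (s≤s (s≤s (s≤s z≤n)))

        bound : ∀ k → suc (2 * (2 + k + 0) + 1) + (2 + 2 * k) ≡ (2 + k) * 4
        bound = Ring.solve-∀

        2k+1<q : ∀ k → 2 ≤ k → q ≡ k * 4 → 2 * (k + 0) + 1 < q
        2k+1<q (suc (suc k)) (s≤s (s≤s _)) refl = subst (2 * (2 + k + 0) + 1 <_) (bound k) (m≤m+n (suc (2 * (2 + k + 0) + 1)) (2 + 2 * k))

        expand : ∀ k → 2 * (2 + k + 0) + 1 ≡ 5 + 2 * k
        expand = Ring.solve-∀

        absurd : ∀ k → 2 ≤ k → q ≡ k * 4 → 3 ≢ 2 * (k + 0) + 1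
        absurd (suc (suc k)) (s≤s (s≤s _)) _ e with () ← trans e (expand k)

%-+-congˡ : ∀ m o n .{{_ : NonZero n}} → (m + o) % n ≡ (m % n + o) % n
%-+-congˡ m o n = trans (cong (λ x → (x + o) % n) (m≡m%n+[m/n]*n m n))
  (trans (cong (_% n) (rearrange (m % n) (m / n * n) o)) ([m+kn]%n≡m%n (m % n + o) (m / n) n))
  where
    rearrange : ∀ x y z → (x + y) + z ≡ (x + z) + y
    rearrange = Ring.solve-∀

-- The lists for `b₁` and `b₃`, read in blocks of pairs.

module Blocks {ℓ₀ ℓ₁ ℓ₂ : Level} (F : HeytingField ℓ₀ ℓ₁ ℓ₂) {q : ℕ} (c : Enumeration F q) where

  open LocalPermutationPolynomials F c
  open CommutativeRing (fieldRing F) using (Carrier; _≈_; setoid)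
    renaming (sym to ≈-sym; trans to ≈-trans)
  open import Relation.Binary.Reasoning.Setoid setoid
  open Enumerated F c
  open Conjugation F c
  open Tuples F c
  open Lists F c

  -- `pairs n` has suc n pairs, and n will be a quotient such as (k ∸ 2) / 2 that does not compute.
  -- N carries the number of pairs in closed form.
  module _ {n N : ℕ} (1+n≡N : suc n ≡ N) {u v : ℕ → ℕ} {ys : List ℕ} where

    length-block : length (pairs n u v ++ ys) ≡ N * 2 + length ys
    length-block = trans (length-++ (pairs n u v)) (cong (_+ length ys) (trans (length-pairs n u v) (cong (_* 2) 1+n≡N)))

    block-even : ∀ {m} → m < N → at 0 (pairs n u v ++ ys) (m * 2) ≡ u m
    block-even {m} m<N = trans (at-++ˡ (pairs n u v) (subst (m * 2 <_) (sym (length-pairs n u v)) (m<n⇒m*2<n*2 m<1+n))) (at-pairs-even n u v m<1+n)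
      where m<1+n = subst (m <_) (sym 1+n≡N) m<N

    block-odd : ∀ {m} → m < N → at 0 (pairs n u v ++ ys) (suc (m * 2)) ≡ v m
    block-odd {m} m<N = trans (at-++ˡ (pairs n u v) (subst (suc (m * 2) <_) (sym (length-pairs n u v)) (m<n⇒1+m*2<n*2 m<1+n))) (at-pairs-odd n u v m<1+n)
      where m<1+n = subst (m <_) (sym 1+n≡N) m<N

    block-rest : ∀ i → at 0 (pairs n u v ++ ys) (N * 2 + i) ≡ at 0 ys i
    block-rest i = at-++ʳ (pairs n u v) (trans (length-pairs n u v) (cong (_* 2) 1+n≡N))

  module Order (g : ℕ) (q≡ : q ≡ (2 + g) * 8) where

    -- In value h is k / 2 and H is k. Unlike `k`, defined as q / 4, they expose successors, so
    -- small bounds hold by computation.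
    h H : ℕ
    h = 2 + g
    H = h + h

    k≡ : k ≡ 4 + g * 2
    k≡ = trans (cong (_/ 4) (trans q≡ (sym (*-assoc h 2 4)))) (m*n/n≡m (h * 2) 4)

    q≡k*4 : q ≡ k * 4
    q≡k*4 = trans q≡ (trans (sym (*-assoc h 2 4)) (cong (_* 4) (sym k≡)))

    1+[k∸2]/2 : suc ((k ∸ 2) / 2) ≡ h
    1+[k∸2]/2 = cong suc (trans (cong (λ k → (k ∸ 2) / 2) k≡) (m*n/n≡m (1 + g) 2))

    1+[k∸4]/2 : suc ((k ∸ 4) / 2) ≡ 1 + g
    1+[k∸4]/2 = cong suc (trans (cong (λ k → (k ∸ 4) / 2) k≡) (m*n/n≡m g 2))

    open Swap (k * 2) (trans q≡k*4 (sym (*-assoc k 2 2))) public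

    a-up : ∀ m {x y} → x ≡ 2 * m → y ≡ 2 * m + 1 → a ⟨ C x ⟩ ≈ C y
    a-up m refl refl = a-even m

    a-down : ∀ m {x y} → x ≡ 2 * m + 1 → y ≡ 2 * m → a ⟨ C x ⟩ ≈ C y
    a-down m refl refl = a-odd m

    <q : ∀ {n} d → suc n + d ≡ h * 8 → n < q
    <q {n} d eq = subst (n <_) (trans eq (sym q≡)) (m≤m+n (suc n) d)

    -- The slacks d and e witness x < y < q, which turns both inequalities into identities in g.
    distinct : ∀ {x y} d e → x + suc d ≡ y → suc y + e ≡ h * 8 → ¬ (C x ≈ C y)
    distinct {x} d e refl eq Cx≈Cy = m≢1+m+n x (trans (C-injective (≤-trans (s≤s (m≤m+n x (suc d))) y<q) y<q Cx≈Cy) (+-suc x d))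
      where y<q = <q e eq

    -- x′ and y′ display how the indices depend on k, so that k can be replaced by 4 + 2 g in them
    -- alone.
    k-distinct : ∀ {x y} (x′ y′ : ℕ → ℕ) d e → x ≡ x′ k → y ≡ y′ k → x′ (4 + g * 2) + suc d ≡ y′ (4 + g * 2) →
                 suc (y′ (4 + g * 2)) + e ≡ h * 8 → ¬ (C x ≈ C y)
    k-distinct x′ y′ d e refl refl eq eq′ Cx≈Cy = distinct d e eq eq′
      (subst (λ k → C (x′ k) ≈ C (y′ k)) k≡ Cx≈Cy)

    -- Here k is a variable of known value, so rewriting reaches it inside the truncated
    -- subtractions.
    private module Entry {k : ℕ} (k≡ : k ≡ 4 + g * 2) where

      v₁ : ∀ r → 2 * (2 * r + k ∸ 1) ≡ 2 * (2 * r + 3 + g * 2)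
      v₁ r rewrite k≡ = cong (2 *_) (trans (cong (_∸ 1) (+-suc (2 * r) (3 + g * 2))) (sym (+-assoc (2 * r) 3 (g * 2))))

      v₁′ : ∀ r → 2 * (2 * r + k) ∸ 1 ≡ 2 * (2 * r + 3 + g * 2) + 1
      v₁′ r rewrite k≡ = cong (_∸ 1) (lemma r g)
        where
          lemma : ∀ r g → 2 * (2 * r + (4 + g * 2)) ≡ suc (2 * (2 * r + 3 + g * 2) + 1)
          lemma = Ring.solve-∀

      last-v₁′ : 4 * k ∸ 5 ≡ 2 * (2 * (1 + g) + 3 + g * 2) + 1
      last-v₁′ rewrite k≡ = cong (_∸ 5) (lemma g)
        where
          lemma : ∀ g → 4 * (4 + g * 2) ≡ 5 + (2 * (2 * (1 + g) + 3 + g * 2) + 1)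
          lemma = Ring.solve-∀

      last-v : 4 * k ∸ 4 ≡ 2 * (2 * (1 + g) + k)
      last-v rewrite k≡ = cong (_∸ 4) (lemma g)
        where
          lemma : ∀ g → 4 * (4 + g * 2) ≡ 4 + (2 * (2 * (1 + g) + (4 + g * 2)))
          lemma = Ring.solve-∀

      last-u : 4 * k ∸ 1 ≡ 2 * (7 + g * 4) + 1
      last-u rewrite k≡ = cong (_∸ 1) (lemma g)
        where
          lemma : ∀ g → 4 * (4 + g * 2) ≡ 1 + (2 * (7 + g * 4) + 1)
          lemma = Ring.solve-∀

      last-u′ : 4 * k ∸ 2 ≡ 2 * (7 + g * 4)
      last-u′ rewrite k≡ = cong (_∸ 2) (lemma g)
        where
          lemma : ∀ g → 4 * (4 + g * 2) ≡ 2 + 2 * (7 + g * 4)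
          lemma = Ring.solve-∀

      middle : ∀ n → 2 * n + k ≡ 2 * (n + 2 + g)
      middle n rewrite k≡ = lemma n g
        where
          lemma : ∀ n g → 2 * n + (4 + g * 2) ≡ 2 * (n + 2 + g)
          lemma = Ring.solve-∀

    -- The modular relations for `b₁`.

    module Modular₁ (free : ∀ x → ¬ (b₁ ⟨ x ⟩ ≈ x)) where

      private
        -- The constructors follow the three pieces of `C₁` and `C₂`: h pairs, then h - 1 pairs,
        -- then one separate pair.
        data Position : ℕ → Set where
          low  : ∀ {r} → r < h → Position r
          mid  : ∀ {n} → n < 1 + g → Position (h + n)
          last : Position (h + (1 + g))

        position : ∀ {r} → r < H → Position r
        position {r} r<H with r <? h
        ... | yes r<h = low r<h
        ... | no r≮h with m≤n⇒∃[o]m+o≡n (≮⇒≥ r≮h)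
        ...   | n , refl with m≤n⇒m<n∨m≡n (≤-pred (+-cancelˡ-< h n h r<H))
        ...     | inj₁ n<1+g = mid n<1+g
        ...     | inj₂ refl  = last

        [h+n]*2 : ∀ n → (h + n) * 2 ≡ h * 2 + n * 2
        [h+n]*2 n = *-distribʳ-+ 2 h n

        -- C₁ reads u 0, v 0, u 1, v 1, … and C₂ reads u′ 0, v′ 0, …, with arguments modulo H = k;
        -- a exchanges u m with u′ m, but v m with v′ (m + h).
        u v u′ v′ : ℕ → ℕ
        u  r = at 0 C₁ (r * 2)
        v  r = at 0 C₁ (suc (r * 2))
        u′ r = at 0 C₂ (r * 2)
        v′ r = at 0 C₂ (suc (r * 2))

        suc-[h+n]*2 : ∀ n → suc ((h + n) * 2) ≡ h * 2 + suc (n * 2)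
        suc-[h+n]*2 n = trans (cong suc ([h+n]*2 n)) (sym (+-suc (h * 2) (n * 2)))

        module _ {u₁ v₁ u₂ v₂ : ℕ → ℕ} {x y : ℕ} where

          private
            L : List ℕ
            L = pairs ((k ∸ 2) / 2) u₁ v₁ ++ pairs ((k ∸ 4) / 2) u₂ v₂ ++ x ∷ y ∷ []

          even-low : ∀ {r} → r < h → at 0 L (r * 2) ≡ u₁ r
          even-low r< = block-even 1+[k∸2]/2 r<

          odd-low : ∀ {r} → r < h → at 0 L (suc (r * 2)) ≡ v₁ r
          odd-low r< = block-odd 1+[k∸2]/2 r<

          even-mid : ∀ {n} → n < 1 + g → at 0 L ((h + n) * 2) ≡ u₂ n
          even-mid {n} n< = trans (cong (at 0 L) ([h+n]*2 n))
            (trans (block-rest 1+[k∸2]/2 (n * 2)) (block-even 1+[k∸4]/2 n<))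

          odd-mid : ∀ {n} → n < 1 + g → at 0 L (suc ((h + n) * 2)) ≡ v₂ n
          odd-mid {n} n< = trans (cong (at 0 L) (suc-[h+n]*2 n))
            (trans (block-rest 1+[k∸2]/2 (suc (n * 2))) (block-odd 1+[k∸4]/2 n<))

          even-last : at 0 L ((h + (1 + g)) * 2) ≡ x
          even-last = trans (cong (at 0 L) (trans ([h+n]*2 (1 + g)) (cong (h * 2 +_) (sym (+-identityʳ _)))))
            (trans (block-rest 1+[k∸2]/2 ((1 + g) * 2 + 0)) (block-rest 1+[k∸4]/2 0))

          odd-last : at 0 L (suc ((h + (1 + g)) * 2)) ≡ y
          odd-last = trans (cong (at 0 L) (trans (suc-[h+n]*2 (1 + g)) (cong (h * 2 +_) (sym (+-comm _ 1)))))
            (trans (block-rest 1+[k∸2]/2 ((1 + g) * 2 + 1)) (block-rest 1+[k∸4]/2 1))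

        H*2≡ : H * 2 ≡ h * 2 + ((1 + g) * 2 + 2)
        H*2≡ = lemma g
          where
            lemma : ∀ g → ((2 + g) + (2 + g)) * 2 ≡ (2 + g) * 2 + ((1 + g) * 2 + 2)
            lemma = Ring.solve-∀

        length-C₁ : length C₁ ≡ H * 2
        length-C₁ = trans (length-block 1+[k∸2]/2) (trans (cong (h * 2 +_) (length-block 1+[k∸4]/2)) (sym H*2≡))

        length-C₂ : length C₂ ≡ H * 2
        length-C₂ = trans (length-block 1+[k∸2]/2) (trans (cong (h * 2 +_) (length-block 1+[k∸4]/2)) (sym H*2≡))

        H*2+H*2≡ : H * 2 + H * 2 ≡ q
        H*2+H*2≡ = trans (lemma h) (sym q≡)
          where
            lemma : ∀ h → (h + h) * 2 + (h + h) * 2 ≡ h * 8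
            lemma = Ring.solve-∀

        surjective : ∀ x → x ∈ map index (C₁ ++ C₂ ++ [])
        surjective = fixedPointFree⇒cover (C₁ ∷ C₂ ∷ []) free

        module B = Covering (C₁ ∷ C₂ ∷ [])
          (trans (length-++ C₁) (trans (cong₂ _+_ length-C₁ (trans (cong length (++-identityʳ C₂)) length-C₂)) H*2+H*2≡))
          surjective

        U V U′ V′ : ℕ → Carrier
        U  m = C (u (m % H))
        V  m = C (v (m % H))
        U′ m = C (u′ (m % H))
        V′ m = C (v′ (m % H))

        odd-step : ∀ ns → ns ∈ C₁ ∷ C₂ ∷ [] → length ns ≡ H * 2 → ∀ m →
                   b₁ ⟨ C (at 0 ns (m % H * 2)) ⟩ ≈ C (at 0 ns (suc (m % H * 2)))
        odd-step ns ns∈ len m = B.step ns∈ (subst (suc (m % H * 2) <_) (sym len) (m<n⇒1+m*2<n*2 (m%n<n m H)))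

        even-step : ∀ ns → ns ∈ C₁ ∷ C₂ ∷ [] → length ns ≡ H * 2 → ∀ m →
                    b₁ ⟨ C (at 0 ns (suc (m % H * 2))) ⟩ ≈ C (at 0 ns (suc m % H * 2))
        even-step ns ns∈ len m with m≤n⇒m<n∨m≡n (m%n<n m H)
        ... | inj₁ lt = ≈-trans (B.step ns∈ (subst (suc (m % H) * 2 <_) (sym len) (m<n⇒m*2<n*2 lt)))
                                (C-reflexive (cong (λ i → at 0 ns (i * 2)) (sym (suc-% m H lt))))
        ... | inj₂ eq = ≈-trans (B.wrap ns∈ (trans (cong (_* 2) eq) (sym len)))
                                (C-reflexive (cong (λ i → at 0 ns (i * 2)) (sym (suc-%-wrap m H eq))))

        bU : ∀ m → b₁ ⟨ U m ⟩ ≈ V m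
        bU = odd-step C₁ (here refl) length-C₁

        bV : ∀ m → b₁ ⟨ V m ⟩ ≈ U (suc m)
        bV = even-step C₁ (here refl) length-C₁

        bU′ : ∀ m → b₁ ⟨ U′ m ⟩ ≈ V′ m
        bU′ = odd-step C₂ (there (here refl)) length-C₂

        bV′ : ∀ m → b₁ ⟨ V′ m ⟩ ≈ U′ (suc m)
        bV′ = even-step C₂ (there (here refl)) length-C₂

        aU : ∀ m → a ⟨ U m ⟩ ≈ U′ m
        aU m = go (position (m%n<n m H))
          where
            go : ∀ {r} → Position r → a ⟨ C (u r) ⟩ ≈ C (u′ r)
            go (low {r} r<) = a-up r (even-low r<) (even-low r<)
            go (mid {n} n<) = a-up (n + 2 + g) (trans (even-mid n<) (Entry.middle k≡ n)) (trans (even-mid n<) (cong (_+ 1) (Entry.middle k≡ n)))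
            -- Only in the separate last pair does `C₁` hold the odd index, 4 k - 1, and `C₂` the
            -- even one, 4 k - 2.
            go last         = a-down (7 + g * 4) (trans even-last (Entry.last-u k≡)) (trans even-last (Entry.last-u′ k≡))

        aV : ∀ m → a ⟨ V m ⟩ ≈ V′ (m + h)
        aV m = subst (λ i → a ⟨ V m ⟩ ≈ C (v′ i)) (sym (%-+-congˡ m h H)) (go (position (m%n<n m H)))
          where
            [h+n+h]%H : ∀ {n} → n < h → ((h + n) + h) % H ≡ n
            [h+n+h]%H {n} n<h = trans (cong (_% H) (lemma h n)) (trans ([m+n]%n≡m%n n H) (m<n⇒m%n≡m (≤-trans n<h (m≤m+n h h))))
              where
                lemma : ∀ h n → (h + n) + h ≡ n + (h + h)
                lemma = Ring.solve-∀

            [r+h]%H : ∀ {r} → r < h → (r + h) % H ≡ h + r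
            [r+h]%H {r} r<h = trans (m<n⇒m%n≡m (+-monoˡ-< h r<h)) (+-comm r h)

            go : ∀ {r} → Position r → a ⟨ C (v r) ⟩ ≈ C (v′ ((r + h) % H))
            -- The partner sits at h + r, in the second block of `C₂`, except that r = h - 1 lands
            -- in the separate last pair.
            go (low {r} r<h) with m≤n⇒m<n∨m≡n (≤-pred r<h)
            ... | inj₁ r<1+g = a-up (2 * r + 3 + g * 2) (trans (odd-low r<h) (Entry.v₁ k≡ r))
                    (trans (cong v′ ([r+h]%H r<h)) (trans (odd-mid r<1+g) (Entry.v₁′ k≡ r)))
            ... | inj₂ refl = a-up (2 * r + 3 + g * 2) (trans (odd-low r<h) (Entry.v₁ k≡ r))
                    (trans (cong v′ ([r+h]%H r<h)) (trans odd-last (Entry.last-v₁′ k≡)))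
            -- From the second half the shift by h wraps around modulo H = 2 h into the first block
            -- of `C₂`.
            go (mid {n} n<) = a-up (2 * n + k) (odd-mid n<) (trans (cong v′ ([h+n+h]%H n<h)) (odd-low n<h))
              where n<h = <-trans n< (n<1+n (1 + g))
            go last = a-up (2 * (1 + g) + k) (trans odd-last (Entry.last-v k≡)) (trans (cong v′ ([h+n+h]%H (n<1+n (1 + g)))) (odd-low (n<1+n (1 + g))))

        aU′ : ∀ m → a ⟨ U′ m ⟩ ≈ U m
        aU′ m = ≈-trans (to-cong a (≈-sym (aU m))) (a∘a (U m))

        V′-periodic : ∀ m → V′ (m + h + h) ≈ V′ m
        V′-periodic m = C-reflexive (cong v′ (trans (cong (_% H) (+-assoc m h h)) ([m+n]%n≡m%n m H)))

        aV′ : ∀ m → a ⟨ V′ m ⟩ ≈ V (m + h)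
        aV′ m = begin
          a ⟨ V′ m ⟩               ≈⟨ to-cong a (V′-periodic m) ⟨
          a ⟨ V′ (m + h + h) ⟩     ≈⟨ to-cong a (aV (m + h)) ⟨
          a ⟨ a ⟨ V (m + h) ⟩ ⟩    ≈⟨ a∘a _ ⟩
          V (m + h)                ∎

        data Point : Carrier → Set (ℓ₀ ⊔ ℓ₁) where
          isU  : ∀ {x} m → x ≈ U m  → Point x
          isV  : ∀ {x} m → x ≈ V m  → Point x
          isU′ : ∀ {x} m → x ≈ U′ m → Point x
          isV′ : ∀ {x} m → x ≈ V′ m → Point x

        -- Covering puts every index in `C₁` or `C₂`; the parity of its position tells the u family
        -- from the v family.
        point : ∀ x → Point x
        point x with ∈-map⁻ index (surjective (Inverse.from c x))
        ... | n , n∈ , eq with ∈-++⁻ C₁ n∈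
        ...   | inj₁ n∈₁ with at-index {d = 0} n∈₁
        ...     | i , i< , n≡ = classify (parity i) (subst (i <_) length-C₁ i<) (≈-trans x≈ (C-reflexive n≡))
          where
            x≈ : x ≈ C n
            x≈ = ≈-trans (≈-sym (Inverse.strictlyInverseˡ c x)) (Inverse.to-cong c eq)
            classify : ∀ {i} → Parity i → i < H * 2 → x ≈ C (at 0 C₁ i) → Point x
            classify (even m) i< x≈ = isU m (≈-trans x≈ (C-reflexive (cong u (sym (m<n⇒m%n≡m (*-cancelʳ-< 2 m H i<))))))
            classify (odd m)  i< x≈ = isV m (≈-trans x≈ (C-reflexive (cong v (sym (m<n⇒m%n≡m (*-cancelʳ-< 2 m H (<-trans (n<1+n _) i<)))))))
        point x | n , n∈ , eq | inj₂ n∈₂ with at-index {d = 0} (subst (n ∈_) (++-identityʳ C₂) n∈₂)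
        ...     | i , i< , n≡ = classify (parity i) (subst (i <_) length-C₂ i<) (≈-trans x≈ (C-reflexive n≡))
          where
            x≈ : x ≈ C n
            x≈ = ≈-trans (≈-sym (Inverse.strictlyInverseˡ c x)) (Inverse.to-cong c eq)
            classify : ∀ {i} → Parity i → i < H * 2 → x ≈ C (at 0 C₂ i) → Point x
            classify (even m) i< x≈ = isU′ m (≈-trans x≈ (C-reflexive (cong u′ (sym (m<n⇒m%n≡m (*-cancelʳ-< 2 m H i<))))))
            classify (odd m)  i< x≈ = isV′ m (≈-trans x≈ (C-reflexive (cong v′ (sym (m<n⇒m%n≡m (*-cancelʳ-< 2 m H (<-trans (n<1+n _) i<)))))))

        ≋-on-points : ∀ {σ τ} → (∀ m → σ ⟨ U m ⟩ ≈ τ ⟨ U m ⟩) → (∀ m → σ ⟨ V m ⟩ ≈ τ ⟨ V m ⟩) →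
                      (∀ m → σ ⟨ U′ m ⟩ ≈ τ ⟨ U′ m ⟩) → (∀ m → σ ⟨ V′ m ⟩ ≈ τ ⟨ V′ m ⟩) → σ ≋ τ
        ≋-on-points {σ} {τ} onU onV onU′ onV′ x with point x
        ... | isU m eq  = ≈-trans (to-cong σ eq) (≈-trans (onU m) (to-cong τ (≈-sym eq)))
        ... | isV m eq  = ≈-trans (to-cong σ eq) (≈-trans (onV m) (to-cong τ (≈-sym eq)))
        ... | isU′ m eq = ≈-trans (to-cong σ eq) (≈-trans (onU′ m) (to-cong τ (≈-sym eq)))
        ... | isV′ m eq = ≈-trans (to-cong σ eq) (≈-trans (onV′ m) (to-cong τ (≈-sym eq)))

        b²U : ∀ m → (b₁ ∘ b₁) ⟨ U m ⟩ ≈ U (suc m)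
        b²U m = ≈-trans (to-cong b₁ (bU m)) (bV m)

        b²V : ∀ m → (b₁ ∘ b₁) ⟨ V m ⟩ ≈ V (suc m)
        b²V m = ≈-trans (to-cong b₁ (bV m)) (bU (suc m))

        b²U′ : ∀ m → (b₁ ∘ b₁) ⟨ U′ m ⟩ ≈ U′ (suc m)
        b²U′ m = ≈-trans (to-cong b₁ (bU′ m)) (bV′ m)

        b²V′ : ∀ m → (b₁ ∘ b₁) ⟨ V′ m ⟩ ≈ V′ (suc m)
        b²V′ m = ≈-trans (to-cong b₁ (bV′ m)) (bU′ (suc m))

      -- `b₁` squared raises m by one in all four families, whereas `a` only changes the family and
      -- adds 0 or h to m.
      b₁²-a : Commute (b₁ ∘ b₁) a
      b₁²-a = ≋-on-points {(b₁ ∘ b₁) ∘ a} {a ∘ (b₁ ∘ b₁)}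
        (λ m → square (aU m)  (b²U′ m)       (b²U m)  (aU (suc m)))
        (λ m → square (aV m)  (b²V′ (m + h)) (b²V m)  (aV (suc m)))
        (λ m → square (aU′ m) (b²U m)        (b²U′ m) (aU′ (suc m)))
        (λ m → square (aV′ m) (b²V (m + h))  (b²V′ m) (aV′ (suc m)))
        where
          square : ∀ {x y y′ z} → a ⟨ x ⟩ ≈ y → (b₁ ∘ b₁) ⟨ y ⟩ ≈ z → (b₁ ∘ b₁) ⟨ x ⟩ ≈ y′ → a ⟨ y′ ⟩ ≈ z →
                   (b₁ ∘ b₁) ⟨ a ⟨ x ⟩ ⟩ ≈ a ⟨ (b₁ ∘ b₁) ⟨ x ⟩ ⟩
          square p p′ r r′ = ≈-trans (≈-trans (to-cong (b₁ ∘ b₁) p) p′) (≈-sym (≈-trans (to-cong a r) r′))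

      private
        abaU : ∀ m → (a ∘ b₁ ∘ a) ⟨ U m ⟩ ≈ V (m + h)
        abaU m = ≈-trans (to-cong (a ∘ b₁) (aU m)) (≈-trans (to-cong a (bU′ m)) (aV′ m))

        abaV : ∀ m → (a ∘ b₁ ∘ a) ⟨ V m ⟩ ≈ U (suc (m + h))
        abaV m = ≈-trans (to-cong (a ∘ b₁) (aV m)) (≈-trans (to-cong a (bV′ (m + h))) (aU′ (suc (m + h))))

        abaU′ : ∀ m → (a ∘ b₁ ∘ a) ⟨ U′ m ⟩ ≈ V′ (m + h)
        abaU′ m = ≈-trans (to-cong (a ∘ b₁) (aU′ m)) (≈-trans (to-cong a (bU m)) (aV m))

        abaV′ : ∀ m → (a ∘ b₁ ∘ a) ⟨ V′ m ⟩ ≈ U′ (suc (m + h))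
        abaV′ m = ≈-trans (to-cong (a ∘ b₁) (aV′ m)) (≈-trans (to-cong a (bV (m + h))) (aU (suc (m + h))))

      -- On all four families a b₁ a acts as the power of `b₁` with exponent 1 + 2 h, the relation
      -- that defines a modular group when b₁ has order 4 h.
      ab₁a-b₁ : Commute (a ∘ b₁ ∘ a) b₁
      ab₁a-b₁ = ≋-on-points {(a ∘ b₁ ∘ a) ∘ b₁} {b₁ ∘ (a ∘ b₁ ∘ a)}
        (λ m → square (bU m)  (abaV m)        (abaU m)  (bV (m + h)))
        (λ m → square (bV m)  (abaU (suc m))  (abaV m)  (bU (suc (m + h))))
        (λ m → square (bU′ m) (abaV′ m)       (abaU′ m) (bV′ (m + h)))
        (λ m → square (bV′ m) (abaU′ (suc m)) (abaV′ m) (bU′ (suc (m + h))))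
        where
          square : ∀ {x y y′ z} → b₁ ⟨ x ⟩ ≈ y → (a ∘ b₁ ∘ a) ⟨ y ⟩ ≈ z → (a ∘ b₁ ∘ a) ⟨ x ⟩ ≈ y′ → b₁ ⟨ y′ ⟩ ≈ z →
                   (a ∘ b₁ ∘ a) ⟨ b₁ ⟨ x ⟩ ⟩ ≈ b₁ ⟨ (a ∘ b₁ ∘ a) ⟨ x ⟩ ⟩
          square p p′ r r′ = ≈-trans (≈-trans (to-cong (a ∘ b₁ ∘ a) p) p′) (≈-sym (≈-trans (to-cong b₁ r) r′))

      b₁²≉1 : ¬ (b₁ ∘ b₁ ≋ id𝔖)
      b₁²≉1 eq = distinct {0} {2} 1 (13 + g * 8) refl refl (≈-trans (≈-sym (eq (C 0))) (≈-trans (b²U 0) (C-reflexive (even-low (s≤s (s≤s z≤n))))))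

      -- At `C 0` the sides are C (2 k + 1) and C (2 k - 1), because `a` pairs v 0 with v′ h and not
      -- with v′ 0.
      b₁a≉ab₁ : ¬ (b₁ ∘ a ≋ a ∘ b₁)
      b₁a≉ab₁ eq = k-distinct (λ k → 2 * (2 * 0 + 3 + g * 2) + 1) (λ k → 2 * (2 * 0 + k) + 1) 1 (6 + g * 4)
        refl refl (lemma g) (lemma′ g) (begin
          C (2 * (2 * 0 + 3 + g * 2) + 1)  ≈⟨ a-up (2 * 0 + 3 + g * 2) (Entry.v₁ k≡ 0) refl ⟨
          a ⟨ V 0 ⟩                        ≈⟨ to-cong a (bU 0) ⟨
          a ⟨ b₁ ⟨ C 0 ⟩ ⟩                 ≈⟨ eq (C 0) ⟨
          b₁ ⟨ a ⟨ C 0 ⟩ ⟩                 ≈⟨ to-cong b₁ (aU 0) ⟩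
          b₁ ⟨ U′ 0 ⟩                      ≈⟨ bU′ 0 ⟩
          V′ 0                             ∎)
        where
          lemma : ∀ g → 2 * (2 * 0 + 3 + g * 2) + 1 + 2 ≡ 2 * (2 * 0 + (4 + g * 2)) + 1
          lemma = Ring.solve-∀
          lemma′ : ∀ g → suc (2 * (2 * 0 + (4 + g * 2)) + 1) + (6 + g * 4) ≡ (2 + g) * 8
          lemma′ = Ring.solve-∀

      -- This square sends U m to U (m + h + 1). The choice m = 1 + g = h - 1 makes the image wrap
      -- exactly to U 0 = C 0, while U m is still in the first block.
      [b₁a]²≉1 : ¬ ((b₁ ∘ a) ∘ (b₁ ∘ a) ≋ id𝔖)
      [b₁a]²≉1 eq = distinct (1 + 2 * g) (13 + g * 6) (lemma g) (lemma′ g) (begin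
        C 0                                   ≡⟨ cong (λ i → C (u i)) [1+g+h]%H ⟨
        U (suc (1 + g + h))                   ≈⟨ bV (1 + g + h) ⟨
        b₁ ⟨ V (1 + g + h) ⟩                  ≈⟨ to-cong b₁ (abaU (1 + g)) ⟨
        b₁ ⟨ a ⟨ b₁ ⟨ a ⟨ U (1 + g) ⟩ ⟩ ⟩ ⟩   ≈⟨ eq (U (1 + g)) ⟩
        U (1 + g)                             ≡⟨ cong (λ i → C (u i)) (m<n⇒m%n≡m (≤-trans (n<1+n (1 + g)) (m≤m+n h h))) ⟩
        C (u (1 + g))                         ≡⟨ cong C (even-low (n<1+n (1 + g))) ⟩
        C (2 * (1 + g))                       ∎)
        where
          [1+g+h]%H : suc (1 + g + h) % H ≡ 0
          [1+g+h]%H = n%n≡0 H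
          lemma : ∀ g → 0 + suc (1 + 2 * g) ≡ 2 * (1 + g)
          lemma = Ring.solve-∀
          lemma′ : ∀ g → suc (2 * (1 + g)) + (13 + g * 6) ≡ (2 + g) * 8
          lemma′ = Ring.solve-∀

    -- Isolated values of `b₃`, enough to break each law at one point.

    module Semidihedral₃ (free : ∀ x → ¬ (b₃ ⟨ x ⟩ ≈ x)) where

      private
        length-D₁ : length D₁ ≡ h * 2 + (2 + (1 + g) * 2)
        length-D₁ = trans (length-block 1+[k∸2]/2) (cong (λ l → h * 2 + (2 + l)) (trans (length-pairs ((k ∸ 4) / 2) _ _) (cong (_* 2) 1+[k∸4]/2)))

        length-D₂ : length D₂ ≡ (1 + g) * 2 + (2 + h * 2)
        length-D₂ = trans (length-block 1+[k∸4]/2) (cong (λ l → (1 + g) * 2 + (2 + l)) (trans (length-pairs ((k ∸ 2) / 2) _ _) (cong (_* 2) 1+[k∸2]/2)))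

        length-sum : ∀ g → ((2 + g) * 2 + (2 + (1 + g) * 2)) + ((1 + g) * 2 + (2 + (2 + g) * 2)) ≡ (2 + g) * 8
        length-sum = Ring.solve-∀

        module B = Covering (D₁ ∷ D₂ ∷ [])
          (trans (length-++ D₁) (trans (cong₂ _+_ length-D₁ (trans (cong length (++-identityʳ D₂)) length-D₂)) (trans (length-sum g) (sym q≡))))
          (fixedPointFree⇒cover (D₁ ∷ D₂ ∷ []) free)

        step₁ : ∀ {i y} → suc i < h * 2 → at 0 D₁ (suc i) ≡ y → b₃ ⟨ C (at 0 D₁ i) ⟩ ≈ C y
        step₁ {i} i< refl = B.step (here refl) (subst (suc i <_) (sym length-D₁) (≤-trans i< (m≤m+n (h * 2) _)))

        b₃-0 : b₃ ⟨ C 0 ⟩ ≈ C (2 * k + 1)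
        b₃-0 = step₁ {0} (s≤s (s≤s z≤n)) refl

        b₃-[2k+1] : b₃ ⟨ C (2 * k + 1) ⟩ ≈ C 2
        b₃-[2k+1] = step₁ {1} (s≤s (s≤s (s≤s z≤n))) (block-even 1+[k∸2]/2 {m = 1} (s≤s (s≤s z≤n)))

        b₃-2k : b₃ ⟨ C (2 * k) ⟩ ≈ C k
        b₃-2k = subst₂ (λ x y → b₃ ⟨ C x ⟩ ≈ C y)
          (trans (cong (at 0 D₂) (sym (+-identityʳ ((1 + g) * 2)))) (block-rest 1+[k∸4]/2 0))
          (trans (cong (at 0 D₂) (sym (+-comm ((1 + g) * 2) 1))) (block-rest 1+[k∸4]/2 1))
          (B.step (there (here refl)) {(1 + g) * 2} (subst (suc ((1 + g) * 2) <_) (sym length-D₂)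
            (subst (_< (1 + g) * 2 + (2 + h * 2)) (+-comm ((1 + g) * 2) 1) (+-monoʳ-< ((1 + g) * 2) (s≤s (s≤s z≤n))))))

        -- Position of the last entry of `D₂`: 1 + g pairs, the two middle entries, 1 + g further
        -- pairs, and the second slot of the last pair.
        final : ℕ
        final = (1 + g) * 2 + suc (suc (suc ((1 + g) * 2)))

        at-final : at 0 D₂ final ≡ 1
        at-final = trans (block-rest 1+[k∸4]/2 (suc (suc (suc ((1 + g) * 2)))))
          (trans (at-pairs-odd ((k ∸ 2) / 2) _ _ (subst (1 + g <_) (sym 1+[k∸2]/2) (n<1+n (1 + g))))
            (trans (cong (λ k → k ∸ 1 ∸ 2 * (1 + g)) k≡) (∸-∸-≡ 1 (2 * (1 + g)) (lemma g))))
          where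
            lemma : ∀ g → 4 + g * 2 ≡ 1 + (2 * (1 + g) + 1)
            lemma = Ring.solve-∀

        -- The entry 1 closes `D₂`, so the cycle wraps to its head; the trailing ∸ 0 is the form
        -- that head takes at j = 0.
        b₃-1 : b₃ ⟨ C 1 ⟩ ≈ C (3 * k ∸ 2 ∸ 0)
        b₃-1 = subst (λ x → b₃ ⟨ C x ⟩ ≈ C (3 * k ∸ 2 ∸ 0)) at-final (B.wrap (there (here refl)) {final}
          (trans (lemma g) (sym length-D₂)))
          where
            lemma : ∀ g → suc ((1 + g) * 2 + suc (suc (suc ((1 + g) * 2)))) ≡ (1 + g) * 2 + (2 + (2 + g) * 2)
            lemma = Ring.solve-∀

        b₃-[3k-2] : b₃ ⟨ C (3 * k ∸ 2 ∸ 0) ⟩ ≈ C (2 * k ∸ 1 ∸ 0)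
        b₃-[3k-2] = B.step (there (here refl)) {0} (subst (1 <_) (sym length-D₂) (s≤s (s≤s z≤n)))

        3k-2 : 3 * k ∸ 2 ∸ 0 ≡ 10 + g * 6
        3k-2 = trans (cong (λ k → 3 * k ∸ 2) k≡) (cong (_∸ 2) (lemma g))
          where
            lemma : ∀ g → 3 * (4 + g * 2) ≡ 2 + (10 + g * 6)
            lemma = Ring.solve-∀

        2k-1 : 2 * k ∸ 1 ∸ 0 ≡ 7 + g * 4
        2k-1 = trans (cong (λ k → 2 * k ∸ 1) k≡) (cong (_∸ 1) (lemma g))
          where
            lemma : ∀ g → 2 * (4 + g * 2) ≡ 1 + (7 + g * 4)
            lemma = Ring.solve-∀

      b₃²≉1 : ¬ (b₃ ∘ b₃ ≋ id𝔖)
      b₃²≉1 eq = distinct {0} {2} 1 (13 + g * 8) refl (lemma g) (≈-trans (≈-sym (eq (C 0))) (≈-trans (to-cong b₃ b₃-0) b₃-[2k+1]))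
        where
          lemma : ∀ g → 3 + (13 + g * 8) ≡ (2 + g) * 8
          lemma = Ring.solve-∀

      -- At `C 0` the sides are C (3 k - 2) and C (2 k).
      b₃a≉ab₃ : ¬ (b₃ ∘ a ≋ a ∘ b₃)
      b₃a≉ab₃ eq = k-distinct (λ k → 2 * k) (λ _ → 10 + g * 6) (1 + g * 2) (5 + g * 2) refl 3k-2 (lemma g) (lemma′ g) (begin
        C (2 * k)              ≈⟨ a-odd k ⟨
        a ⟨ C (2 * k + 1) ⟩    ≈⟨ to-cong a b₃-0 ⟨
        a ⟨ b₃ ⟨ C 0 ⟩ ⟩       ≈⟨ eq (C 0) ⟨
        b₃ ⟨ a ⟨ C 0 ⟩ ⟩       ≈⟨ to-cong b₃ (a-even 0) ⟩
        b₃ ⟨ C 1 ⟩             ≈⟨ b₃-1 ⟩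
        C (3 * k ∸ 2 ∸ 0)      ∎)
        where
          lemma : ∀ g → 2 * (4 + g * 2) + suc (1 + g * 2) ≡ 10 + g * 6
          lemma = Ring.solve-∀
          lemma′ : ∀ g → suc (10 + g * 6) + (5 + g * 2) ≡ (2 + g) * 8
          lemma′ = Ring.solve-∀

      -- The point `C 1` is followed through C 0, C (2 k + 1) and C (2 k) to C k, with k ≥ 4.
      [b₃a]²≉1 : ¬ ((b₃ ∘ a) ∘ (b₃ ∘ a) ≋ id𝔖)
      [b₃a]²≉1 eq = k-distinct (λ _ → 1) (λ k → k) (2 + g * 2) (11 + g * 6) refl refl (lemma g) (lemma′ g) (begin
        C 1                            ≈⟨ eq (C 1) ⟨
        b₃ ⟨ a ⟨ b₃ ⟨ a ⟨ C 1 ⟩ ⟩ ⟩ ⟩  ≈⟨ to-cong b₃ (to-cong a (to-cong b₃ (a-odd 0))) ⟩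
        b₃ ⟨ a ⟨ b₃ ⟨ C 0 ⟩ ⟩ ⟩        ≈⟨ to-cong b₃ (to-cong a b₃-0) ⟩
        b₃ ⟨ a ⟨ C (2 * k + 1) ⟩ ⟩     ≈⟨ to-cong b₃ (a-odd k) ⟩
        b₃ ⟨ C (2 * k) ⟩               ≈⟨ b₃-2k ⟩
        C k                            ∎)
        where
          lemma : ∀ g → 1 + suc (2 + g * 2) ≡ 4 + g * 2
          lemma = Ring.solve-∀
          lemma′ : ∀ g → suc (4 + g * 2) + (11 + g * 6) ≡ (2 + g) * 8
          lemma′ = Ring.solve-∀

      -- At `C 0` the sides are C (2 k - 1) and C 3. This failure is what tells `G₃` from the
      -- modular `G₁`.
      b₃²a≉ab₃² : ¬ Commute (b₃ ∘ b₃) a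
      b₃²a≉ab₃² eq = k-distinct (λ _ → 3) (λ _ → 7 + g * 4) (3 + g * 4) (8 + g * 4) refl 2k-1 refl (lemma g) (begin
        C 3                            ≈⟨ a-even 1 ⟨
        a ⟨ C 2 ⟩                      ≈⟨ to-cong a (≈-trans (to-cong b₃ b₃-0) b₃-[2k+1]) ⟨
        a ⟨ b₃ ⟨ b₃ ⟨ C 0 ⟩ ⟩ ⟩        ≈⟨ eq (C 0) ⟨
        b₃ ⟨ b₃ ⟨ a ⟨ C 0 ⟩ ⟩ ⟩        ≈⟨ to-cong b₃ (to-cong b₃ (a-even 0)) ⟩
        b₃ ⟨ b₃ ⟨ C 1 ⟩ ⟩              ≈⟨ to-cong b₃ b₃-1 ⟩
        b₃ ⟨ C (3 * k ∸ 2 ∸ 0) ⟩       ≈⟨ b₃-[3k-2] ⟩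
        C (2 * k ∸ 1 ∸ 0)              ∎)
        where
          lemma : ∀ g → suc (7 + g * 4) + (8 + g * 4) ≡ (2 + g) * 8
          lemma = Ring.solve-∀

-- Pulling the laws back along an equivalence.

module Inequivalence {ℓ₀ ℓ₁ ℓ₂ : Level} (F : HeytingField ℓ₀ ℓ₁ ℓ₂) {q : ℕ} (c : Enumeration F q) where

  open LocalPermutationPolynomials F c
  open CommutativeRing (fieldRing F) using () renaming (sym to ≈-sym; trans to ≈-trans)
  open Enumerated F c
  open Conjugation F c
  open Tuples F c
  open Dihedral₂ F c using (module Relation₂)
  open Blocks F c using (module Order)

  -- Conjugation is an injective homomorphism, so relations between conjugates descend.
  conj-commute : ∀ σ {τ υ} → Commute (conj σ τ) (conj σ υ) → Commute τ υ
  conj-commute σ {τ} {υ} eq = conj-injective σ {τ ∘ υ} {υ ∘ τ}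
    (≋-trans {conj σ (τ ∘ υ)} {conj σ τ ∘ conj σ υ} {conj σ (υ ∘ τ)} (≋-sym {conj σ τ ∘ conj σ υ} {conj σ (τ ∘ υ)} (conj-∘ σ τ υ))
      (≋-trans {conj σ τ ∘ conj σ υ} {conj σ υ ∘ conj σ τ} {conj σ (υ ∘ τ)} eq (conj-∘ σ υ τ)))

  conj-involution : ∀ σ {τ} → conj σ τ ∘ conj σ τ ≋ id𝔖 → τ ∘ τ ≋ id𝔖
  conj-involution σ {τ} eq = conj-injective σ {τ ∘ τ} {id𝔖}
    (≋-trans {conj σ (τ ∘ τ)} {conj σ τ ∘ conj σ τ} {conj σ id𝔖} (≋-sym {conj σ τ ∘ conj σ τ} {conj σ (τ ∘ τ)} (conj-∘ σ τ τ))
      (≋-trans {conj σ τ ∘ conj σ τ} {id𝔖} {conj σ id𝔖} eq (≋-sym {conj σ id𝔖} {id𝔖} (inverseʳ σ))))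

  module _ {m b f} (consists : tuple f ConsistsOf Products m b 2 a) (m≥2 : 2 ≤ m) (ba≉ab : ¬ Commute b a) where

    private
      m≥1 : 1 ≤ m
      m≥1 = ≤-trans (s≤s z≤n) m≥2

    nonabelian⇒≁Klenian : ∀ p .{{_ : NonZero p}} e → p ^ e ∣ q → ∀ {g} → IsKlenian p e g → ¬ Equivalent f g
    nonabelian⇒≁Klenian p e p^e∣q {g} klenian eq
      with Equivalent⇒conj {f = f} {g} {G = Products m b 2 a} eq consists klenian (Bicommutant-absorbs {α} {β}) (∋-1 m≥1 (s≤s z≤n))
      where open Klenian p e
    ... | σ , φ = ba≉ab (conj-commute σ {b} {a} (Bicommutant-commutes {α} {β} αβ-commute {conj σ b} {conj σ a}
            (φ b (∋-b m≥2 (s≤s z≤n))) (φ a (∋-a m≥1 (s≤s (s≤s z≤n))))))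
      where
        open Klenian p e
        open KlenianGroup p e p^e∣q

    -- The law is tested on b and b a: the pair b, a would satisfy it trivially, since a is an
    -- involution.
    ≁dihedral : ¬ (b ∘ b ≋ id𝔖) → ¬ ((b ∘ a) ∘ (b ∘ a) ≋ id𝔖) → a ∘ a ≋ id𝔖 → ∀ {m′ b′} → b′ ∘ a ∘ b′ ≋ a →
                ∀ {g} → tuple g ConsistsOf Products m′ b′ 2 a → ¬ Equivalent f g
    ≁dihedral b²≉1 [ba]²≉1 aa {m′} {b′} bab {g} consists′ eq
      with Equivalent⇒conj {f = f} {g} {G = Products m b 2 a} eq consists consists′ (Dihedral.absorbs b′ a aa bab) (∋-1 m≥1 (s≤s z≤n))
    ... | σ , φ with Dihedral.law b′ a aa bab {conj σ b} {conj σ (b ∘ a)} (φ b (∋-b m≥2 (s≤s z≤n))) (φ (b ∘ a) (∋-ba m≥2 (s≤s (s≤s z≤n))))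
    ...   | inj₁ p        = b²≉1 (conj-involution σ {b} p)
    ...   | inj₂ (inj₁ p) = [ba]²≉1 (conj-involution σ {b ∘ a} p)
    ...   | inj₂ (inj₂ p) = ba≉ab (λ x → cancel x)
      where
        cancel : Commute b a
        -- Commuting with b a reads b b a = b a b; cancelling the leftmost b gives b a = a b.
        cancel x = ≈-trans (≈-sym (inverseˡ b _)) (≈-trans (to-cong (b ⁻¹) (conj-commute σ {b} {b ∘ a} p x)) (inverseˡ b _))

    ≁modular : ¬ Commute (b ∘ b) a → a ∘ a ≋ id𝔖 → ∀ {m′ b′} → Commute (b′ ∘ b′) a → Commute (a ∘ b′ ∘ a) b′ →
               ∀ {g} → tuple g ConsistsOf Products m′ b′ 2 a → ¬ Equivalent f g
    ≁modular b²a≉ab² aa {m′} {b′} bba aba-b {g} consists′ eq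
      with Equivalent⇒conj {f = f} {g} {G = Products m b 2 a} eq consists consists′ (Modular.absorbs b′ a aa bba aba-b) (∋-1 m≥1 (s≤s z≤n))
    ... | σ , φ = b²a≉ab² (conj-commute σ {b ∘ b} {a} (Commute-resp {conj σ b ∘ conj σ b} {conj σ (b ∘ b)} {conj σ a} (conj-∘ σ b b)
            (Modular.law b′ a aa bba aba-b {conj σ b} {conj σ a} (φ b (∋-b m≥2 (s≤s z≤n))) (φ a (∋-a m≥1 (s≤s (s≤s z≤n)))))))

  module _ (g : ℕ) (q≡ : q ≡ (2 + g) * 8) {f₁ f₂ f₃ : LPP}
           (consists₁ : tuple f₁ ConsistsOf G₁) (consists₂ : tuple f₂ ConsistsOf G₂) (consists₃ : tuple f₃ ConsistsOf G₃) where

    open Order g q≡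

    private
      k≥2 : 2 ≤ k
      k≥2 = subst (2 ≤_) (sym k≡) (s≤s (s≤s z≤n))

      2k≥2 : 2 ≤ 2 * k
      2k≥2 = ≤-trans k≥2 (m≤m+n k (k + 0))

      q/2≥2 : 2 ≤ q / 2
      q/2≥2 = subst (2 ≤_) (sym q/2≡) (≤-trans k≥2 (m≤m*n k 2))
        where
          q/2≡ : q / 2 ≡ k * 2
          q/2≡ = trans (cong (_/ 2) (trans q≡k*4 (sym (*-assoc k 2 2)))) (m*n/n≡m (k * 2) 2)

      q>2 : 2 < q
      q>2 = subst (2 <_) (sym q≡) (s≤s (s≤s (s≤s z≤n)))

      module M = Modular₁ (generator-fixedPointFree {f₁} consists₁ 2k≥2 q>2)
      module D = Relation₂ q≡k*4 (generator-fixedPointFree {f₂} consists₂ q/2≥2 q>2)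
      module S = Semidihedral₃ (generator-fixedPointFree {f₃} consists₃ 2k≥2 q>2)

    ≁Klenian : ∀ p .{{_ : NonZero p}} e → p ^ e ∣ q → ∀ {g} → IsKlenian p e g →
               ¬ Equivalent f₁ g × ¬ Equivalent f₂ g × ¬ Equivalent f₃ g
    ≁Klenian p e p^e∣q {g} klenian =
        nonabelian⇒≁Klenian {f = f₁} consists₁ 2k≥2 M.b₁a≉ab₁ p e p^e∣q {g} klenian
      , nonabelian⇒≁Klenian {f = f₂} consists₂ q/2≥2 (D.b₂a≉ab₂ k≥2) p e p^e∣q {g} klenian
      , nonabelian⇒≁Klenian {f = f₃} consists₃ 2k≥2 S.b₃a≉ab₃ p e p^e∣q {g} klenian

    -- The violated law must belong to the target of the equivalence. `G₃` breaks the laws of both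
    -- `G₁` and `G₂`, so the last two equivalences are first reversed.
    pairwise-≁ : ¬ Equivalent f₁ f₂ × ¬ Equivalent f₁ f₃ × ¬ Equivalent f₂ f₃
    pairwise-≁ =
        ≁dihedral {f = f₁} consists₁ 2k≥2 M.b₁a≉ab₁ M.b₁²≉1 M.[b₁a]²≉1 a∘a D.b₂ab₂ {f₂} consists₂
      , (λ eq → ≁modular {f = f₃} consists₃ 2k≥2 S.b₃a≉ab₃ S.b₃²a≉ab₃² a∘a M.b₁²-a M.ab₁a-b₁ {f₁} consists₁ (Equivalent-sym {f₁} {f₃} eq))
      , (λ eq → ≁dihedral {f = f₃} consists₃ 2k≥2 S.b₃a≉ab₃ S.b₃²≉1 S.[b₃a]²≉1 a∘a D.b₂ab₂ {f₂} consists₂ (Equivalent-sym {f₂} {f₃} eq))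

-- Arithmetic of powers of two, and the assembly of the results.

^-∣ : ∀ p {e r} → e ≤ r → p ^ e ∣ p ^ r
^-∣ p {e} e≤r with m≤n⇒∃[o]m+o≡n e≤r
... | o , refl = divides (p ^ o) (trans (^-distribˡ-+-* p e o) (*-comm (p ^ e) (p ^ o)))

2^r≡[2+g]*8 : ∀ {r} → 4 ≤ r → ∃ λ g → 2 ^ r ≡ (2 + g) * 8
-- After matching, r is the exponent less 4, so 2 * 2 ^ r is one eighth of the power and at least 2;
-- g is its excess over 2.
2^r≡[2+g]*8 {suc (suc (suc (suc r)))} (s≤s (s≤s (s≤s (s≤s z≤n)))) with m≤n⇒∃[o]m+o≡n (*-monoʳ-≤ 2 (m^n>0 2 r))
... | g , eq = g , trans (lemma (2 * 2 ^ r)) (cong (_* 8) (sym eq))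
  where
    lemma : ∀ x → 2 * (2 * (2 * x)) ≡ x * 8
    lemma = Ring.solve-∀

theorem3p5 : ∀ {a ℓ₁ ℓ₂ : Level} (F : HeytingField a ℓ₁ ℓ₂) (r : ℕ) → 4 ≤ r →
    (c : Enumeration F (2 ^ r)) →
    let open LocalPermutationPolynomials F c in
    (f₁ f₂ f₃ : LPP) →
    tuple f₁ ConsistsOf G₁ → tuple f₂ ConsistsOf G₂ → tuple f₃ ConsistsOf G₃ →
    (∀ e → e < r → ∀ (g : LPP) → IsKlenian 2 e g →
    ¬ Equivalent f₁ g × ¬ Equivalent f₂ g × ¬ Equivalent f₃ g)
    × ¬ Equivalent f₁ f₂ × ¬ Equivalent f₁ f₃ × ¬ Equivalent f₂ f₃
theorem3p5 F r r≥4 c f₁ f₂ f₃ consists₁ consists₂ consists₃ with 2^r≡[2+g]*8 r≥4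
... | g , q≡ =
    (λ e e<r f → ≁Klenian g q≡ {f₁} {f₂} {f₃} consists₁ consists₂ consists₃ 2 e (^-∣ 2 (<⇒≤ e<r)) {f})
  , pairwise-≁ g q≡ {f₁} {f₂} {f₃} consists₁ consists₂ consists₃
  where open Inequivalence F c
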